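{- For every integer $k\geq 4$, no tree is $k$-NIM.
   Context: For a tree $T$ with vertex set $\{1,\dots,n\}$, $\mathcal{S}(T)$ denotes the set of real symmetric $n\times n$ matrices $A=(a_{ij})$ such that for $i\neq j$, $a_{ij}\neq 0$ if and only if $\{i,j\}$ is an edge of $T$. For $A\in\mathcal{S}(T)$ and $\lambda\in\mathbb{R}$, $\mathrm{m}_A(\lambda)$ is the multiplicity of $\lambda$ as an eigenvalue of $A$, and $M(T)$ is the maximum of $\mathrm{m}_A(\lambda)$ over all $A\in\mathcal{S}(T)$, $\lambda\in\mathbb{R}$. For an integer $k\geq1$, $T$ is $k$-NIM if $M(T)\geq k$ and, whenever $A\in\mathcal{S}(T)$ has an eigenvalue $\lambda$ with $\mathrm{m}_A(\lambda)=M(T)-(k-1)\geq 2$, every other eigenvalue of $A$ has multiplicity $1$.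
   Formalization: The condition M(T)-(k-1) ≥ 2 is made part of the definition of k-NIM rather than of the "whenever" premise; read literally, every tree with M(T)=k (e.g. the star with 5 leaves, k=4) would be vacuously k-NIM and the claim false. -}

module Defs where

open import Algebra.Bundles.Raw using (RawMonoid)
import Algebra.Definitions.RawMonoid as RawMonoidDefinitions
open import Data.Fin.Base using (Fin; zero; suc; inject₁; fromℕ)
open import Data.Nat.Base as ℕ using (ℕ; _∸_)
import Data.Nat.Properties as ℕ
open import Data.Product.Base using (Σ; ∃; ∃-syntax; _×_; _,_; proj₁; proj₂)
open import Data.Rational.Base as ℚ using (ℚ; 0ℚ; 1ℚ; ½; ∣_∣; Positive)
import Data.Rational.Properties as ℚ
open import Data.Rational.Solver using (module +-*-Solver)
open import Data.Vec.Functional using (Vector)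
open import Function.Bundles using (_⇔_)
open import Function.Definitions using (Injective)
open import Level using (0ℓ)
open import Relation.Binary.Construct.Closure.ReflexiveTransitive using (Star)
open import Relation.Binary.Core using (Rel)
open import Relation.Binary.Definitions using (Decidable; Irreflexive; Symmetric)
open import Relation.Binary.PropositionalEquality
open import Relation.Nullary.Negation using (¬_)

------------------------------------------------------------------------
-- Real numbers

-- ℝ is the setoid of Cauchy sequences of rationals, two sequences being
-- equal when their difference tends to 0.  An order on ℝ is not needed.
-- Equality is a record, and the operations below are defined by copatterns,
-- so that normalisation does not unfold arithmetic in ℚ.

IsCauchy : (ℕ → ℚ) → Set
IsCauchy x = ∀ ε → .{{Positive ε}} →
  ∃[ N ] ∀ m n → N ℕ.≤ m → N ℕ.≤ n → ∣ x m ℚ.- x n ∣ ℚ.≤ ε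

record ℝ : Set where
  field
    seq    : ℕ → ℚ
    cauchy : IsCauchy seq

open ℝ public

infix 4 _≈_ _≉_

record _≈_ (x y : ℝ) : Set where
  constructor mk≈
  field
    eventually-close : ∀ ε → .{{Positive ε}} →
      ∃[ N ] ∀ n → N ℕ.≤ n → ∣ seq x n ℚ.- seq y n ∣ ℚ.≤ ε

_≉_ : Rel ℝ 0ℓ
x ≉ y = ¬ (x ≈ y)

private
  const-isCauchy : ∀ q → IsCauchy (λ _ → q)
  const-isCauchy q ε = 0 , λ _ _ _ _ → begin
    ∣ q ℚ.- q ∣  ≡⟨ cong ∣_∣ (ℚ.+-inverseʳ q) ⟩
    0ℚ           ≤⟨ ℚ.nonNegative⁻¹ ε {{ℚ.pos⇒nonNeg ε}} ⟩
    ε            ∎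
    where open ℚ.≤-Reasoning

  halves : ∀ ε → ½ ℚ.* ε ℚ.+ ½ ℚ.* ε ≡ ε
  halves ε = trans (sym (ℚ.*-distribʳ-+ ε ½ ½)) (ℚ.*-identityˡ ε)

  sum-isCauchy : ∀ {x y} → IsCauchy x → IsCauchy y →
                 IsCauchy (λ n → x n ℚ.+ y n)
  sum-isCauchy {x} {y} cx cy ε = Nx ℕ.⊔ Ny , λ m n N≤m N≤n → begin
    ∣ (x m ℚ.+ y m) ℚ.- (x n ℚ.+ y n) ∣
      ≡⟨ cong ∣_∣ (rearrange (x m) (y m) (x n) (y n)) ⟩
    ∣ (x m ℚ.- x n) ℚ.+ (y m ℚ.- y n) ∣
      ≤⟨ ℚ.∣p+q∣≤∣p∣+∣q∣ (x m ℚ.- x n) (y m ℚ.- y n) ⟩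
    ∣ x m ℚ.- x n ∣ ℚ.+ ∣ y m ℚ.- y n ∣
      ≤⟨ ℚ.+-mono-≤
           (hx m n (ℕ.m⊔n≤o⇒m≤o Nx Ny N≤m) (ℕ.m⊔n≤o⇒m≤o Nx Ny N≤n))
           (hy m n (ℕ.m⊔n≤o⇒n≤o Nx Ny N≤m) (ℕ.m⊔n≤o⇒n≤o Nx Ny N≤n)) ⟩
    ½ ℚ.* ε ℚ.+ ½ ℚ.* ε
      ≡⟨ halves ε ⟩
    ε ∎
    where
    open ℚ.≤-Reasoning
    instance
      δ-pos : Positive (½ ℚ.* ε)
      δ-pos = ℚ.pos*pos⇒pos ½ ε
    Nx = proj₁ (cx (½ ℚ.* ε))
    hx = proj₂ (cx (½ ℚ.* ε))
    Ny = proj₁ (cy (½ ℚ.* ε))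
    hy = proj₂ (cy (½ ℚ.* ε))
    rearrange : ∀ a b c d → (a ℚ.+ b) ℚ.- (c ℚ.+ d) ≡ (a ℚ.- c) ℚ.+ (b ℚ.- d)
    rearrange = solve 4 (λ a b c d →
      (a :+ b) :- (c :+ d) := (a :- c) :+ (b :- d)) refl
      where open +-*-Solver

  eventually-bounded : ∀ {x} → IsCauchy x →
    ∃[ B ] Positive B × ∃[ N ] ∀ n → N ℕ.≤ n → ∣ x n ∣ ℚ.≤ B
  eventually-bounded {x} cx =
    1ℚ ℚ.+ ∣ x N ∣ , B-pos , N , λ n N≤n → begin
      ∣ x n ∣                        ≡⟨ cong ∣_∣ (split (x n) (x N)) ⟩
      ∣ (x n ℚ.- x N) ℚ.+ x N ∣      ≤⟨ ℚ.∣p+q∣≤∣p∣+∣q∣ (x n ℚ.- x N) (x N) ⟩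
      ∣ x n ℚ.- x N ∣ ℚ.+ ∣ x N ∣    ≤⟨ ℚ.+-monoˡ-≤ ∣ x N ∣ (h n N N≤n ℕ.≤-refl) ⟩
      1ℚ ℚ.+ ∣ x N ∣                 ∎
    where
    open ℚ.≤-Reasoning
    N = proj₁ (cx 1ℚ)
    h = proj₂ (cx 1ℚ)
    B-pos : Positive (1ℚ ℚ.+ ∣ x N ∣)
    B-pos = ℚ.positive
      (ℚ.+-mono-<-≤ (ℚ.positive⁻¹ 1ℚ) (ℚ.0≤∣p∣ (x N)))
    split : ∀ a b → a ≡ (a ℚ.- b) ℚ.+ b
    split = solve 2 (λ a b → a := (a :- b) :+ b) refl
      where open +-*-Solver

  product-bound : ∀ {B C δ} → Positive B → Positive C →
    ∀ a b c d → ∣ a ∣ ℚ.≤ B → ∣ d ∣ ℚ.≤ C →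
    ∣ b ℚ.- d ∣ ℚ.≤ δ → ∣ a ℚ.- c ∣ ℚ.≤ δ →
    ∣ a ℚ.* b ℚ.- c ℚ.* d ∣ ℚ.≤ (B ℚ.+ C) ℚ.* δ
  product-bound {B} {C} {δ} B-pos C-pos a b c d a≤B d≤C b-d≤δ a-c≤δ = begin
    ∣ a ℚ.* b ℚ.- c ℚ.* d ∣
      ≡⟨ cong ∣_∣ (rearrange a b c d) ⟩
    ∣ a ℚ.* (b ℚ.- d) ℚ.+ d ℚ.* (a ℚ.- c) ∣
      ≤⟨ ℚ.∣p+q∣≤∣p∣+∣q∣ (a ℚ.* (b ℚ.- d)) (d ℚ.* (a ℚ.- c)) ⟩
    ∣ a ℚ.* (b ℚ.- d) ∣ ℚ.+ ∣ d ℚ.* (a ℚ.- c) ∣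
      ≤⟨ ℚ.+-mono-≤ (bound B-pos a (b ℚ.- d) a≤B b-d≤δ)
                    (bound C-pos d (a ℚ.- c) d≤C a-c≤δ) ⟩
    B ℚ.* δ ℚ.+ C ℚ.* δ
      ≡⟨ sym (ℚ.*-distribʳ-+ δ B C) ⟩
    (B ℚ.+ C) ℚ.* δ ∎
    where
    open ℚ.≤-Reasoning
    bound : ∀ {D} → Positive D → ∀ p q → ∣ p ∣ ℚ.≤ D → ∣ q ∣ ℚ.≤ δ →
            ∣ p ℚ.* q ∣ ℚ.≤ D ℚ.* δ
    bound {D} D-pos p q p≤D q≤δ = begin
      ∣ p ℚ.* q ∣        ≡⟨ ℚ.∣p*q∣≡∣p∣*∣q∣ p q ⟩
      ∣ p ∣ ℚ.* ∣ q ∣    ≤⟨ ℚ.*-monoʳ-≤-nonNeg ∣ q ∣ {{ℚ.∣-∣-nonNeg q}} p≤D ⟩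
      D ℚ.* ∣ q ∣        ≤⟨ ℚ.*-monoˡ-≤-nonNeg D {{ℚ.pos⇒nonNeg D {{D-pos}}}} q≤δ ⟩
      D ℚ.* δ            ∎
    rearrange : ∀ a b c d →
      a ℚ.* b ℚ.- c ℚ.* d ≡ a ℚ.* (b ℚ.- d) ℚ.+ d ℚ.* (a ℚ.- c)
    rearrange = solve 4 (λ a b c d →
      a :* b :- c :* d := a :* (b :- d) :+ d :* (a :- c)) refl
      where open +-*-Solver

  divide : ∀ p → Positive p → ∀ ε → .{{Positive ε}} →
           ∃[ δ ] Positive δ × p ℚ.* δ ≡ ε
  divide p p-pos ε =
    ℚ.1/ p ℚ.* ε
    , ℚ.pos*pos⇒pos (ℚ.1/ p) {{ℚ.1/pos⇒pos p {{p-pos}}}} ε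
    , trans (sym (ℚ.*-assoc p (ℚ.1/ p) ε))
        (trans (cong (ℚ._* ε) (ℚ.*-inverseʳ p)) (ℚ.*-identityˡ ε))
    where
    instance
      p-nonZero : ℚ.NonZero p
      p-nonZero = ℚ.pos⇒nonZero p {{p-pos}}

  product-isCauchy : ∀ {x y} → IsCauchy x → IsCauchy y →
                     IsCauchy (λ n → x n ℚ.* y n)
  product-isCauchy {x} {y} cx cy ε =
    from-bounds (eventually-bounded cx) (eventually-bounded cy)
    where
    Goal : Set
    Goal = ∃[ N ] ∀ m n → N ℕ.≤ m → N ℕ.≤ n →
      ∣ x m ℚ.* y m ℚ.- x n ℚ.* y n ∣ ℚ.≤ ε
    from-bounds :
      (∃[ B ] Positive B × ∃[ N ] ∀ n → N ℕ.≤ n → ∣ x n ∣ ℚ.≤ B) →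
      (∃[ C ] Positive C × ∃[ N ] ∀ n → N ℕ.≤ n → ∣ y n ∣ ℚ.≤ C) → Goal
    from-bounds (B , B-pos , Mx , x≤B) (C , C-pos , My , y≤C) =
      from-δ (divide (B ℚ.+ C) (ℚ.pos+pos⇒pos B {{B-pos}} C {{C-pos}}) ε)
      where
      from-δ : (∃[ δ ] Positive δ × (B ℚ.+ C) ℚ.* δ ≡ ε) → Goal
      from-δ (δ , δ-pos , eq) = from-moduli (cx δ {{δ-pos}}) (cy δ {{δ-pos}})
        where
        from-moduli :
          (∃[ N ] ∀ m n → N ℕ.≤ m → N ℕ.≤ n → ∣ x m ℚ.- x n ∣ ℚ.≤ δ) →
          (∃[ N ] ∀ m n → N ℕ.≤ m → N ℕ.≤ n → ∣ y m ℚ.- y n ∣ ℚ.≤ δ) → Goal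
        from-moduli (Nx , hx) (Ny , hy) =
          (Mx ℕ.⊔ My) ℕ.⊔ (Nx ℕ.⊔ Ny) , λ m n N≤m N≤n →
          let
            M≤m = ℕ.m⊔n≤o⇒m≤o (Mx ℕ.⊔ My) (Nx ℕ.⊔ Ny) N≤m
            M≤n = ℕ.m⊔n≤o⇒m≤o (Mx ℕ.⊔ My) (Nx ℕ.⊔ Ny) N≤n
            N≤m = ℕ.m⊔n≤o⇒n≤o (Mx ℕ.⊔ My) (Nx ℕ.⊔ Ny) N≤m
            N≤n = ℕ.m⊔n≤o⇒n≤o (Mx ℕ.⊔ My) (Nx ℕ.⊔ Ny) N≤n
          in
          subst (∣ x m ℚ.* y m ℚ.- x n ℚ.* y n ∣ ℚ.≤_) eq
            (product-bound B-pos C-pos (x m) (y m) (x n) (y n)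
              (x≤B m (ℕ.m⊔n≤o⇒m≤o Mx My M≤m))
              (y≤C n (ℕ.m⊔n≤o⇒n≤o Mx My M≤n))
              (hy m n (ℕ.m⊔n≤o⇒n≤o Nx Ny N≤m) (ℕ.m⊔n≤o⇒n≤o Nx Ny N≤n))
              (hx m n (ℕ.m⊔n≤o⇒m≤o Nx Ny N≤m) (ℕ.m⊔n≤o⇒m≤o Nx Ny N≤n)))

fromℚ : ℚ → ℝ
seq    (fromℚ q) _ = q
cauchy (fromℚ q)   = const-isCauchy q

0ℝ : ℝ
0ℝ = fromℚ 0ℚ

infixl 6 _+_
infixl 7 _*_

_+_ : ℝ → ℝ → ℝ
seq    (x + y) n = seq x n ℚ.+ seq y n
cauchy (x + y)   = sum-isCauchy {seq x} {seq y} (cauchy x) (cauchy y)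

_*_ : ℝ → ℝ → ℝ
seq    (x * y) n = seq x n ℚ.* seq y n
cauchy (x * y)   = product-isCauchy {seq x} {seq y} (cauchy x) (cauchy y)

+-0-rawMonoid : RawMonoid 0ℓ 0ℓ
+-0-rawMonoid = record { Carrier = ℝ ; _≈_ = _≈_ ; _∙_ = _+_ ; ε = 0ℝ }

open RawMonoidDefinitions +-0-rawMonoid public using (sum)

------------------------------------------------------------------------
-- Vectors, matrices and eigenvalues

Matrix : ℕ → Set
Matrix n = Fin n → Fin n → ℝ

infixr 7 _·_

_·_ : ∀ {n} → Matrix n → Vector ℝ n → Vector ℝ n
(A · v) i = sum (λ j → A i j * v j)

IsSymmetric : ∀ {n} → Matrix n → Set
IsSymmetric A = ∀ i j → A i j ≈ A j i

IsZero : ∀ {n} → Vector ℝ n → Set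
IsZero v = ∀ i → v i ≈ 0ℝ

InEigenspace : ∀ {n} → Matrix n → ℝ → Vector ℝ n → Set
InEigenspace A λ′ v = ∀ i → (A · v) i ≈ λ′ * v i

IsEigenvalue : ∀ {n} → Matrix n → ℝ → Set
IsEigenvalue A λ′ = ∃[ v ] InEigenspace A λ′ v × ¬ IsZero v

combination : ∀ {n r} → Vector ℝ r → Vector (Vector ℝ n) r → Vector ℝ n
combination c b i = sum (λ s → c s * b s i)

record IsEigenbasis {n r} (A : Matrix n) (λ′ : ℝ) (b : Vector (Vector ℝ n) r) : Set where
  field
    members     : ∀ s → InEigenspace A λ′ (b s)
    independent : ∀ c → IsZero (combination c b) → IsZero c
    spanning    : ∀ v → InEigenspace A λ′ v →
                  ∃[ c ] ∀ i → v i ≈ combination c b i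

-- The multiplicity of λ′ is taken to be the dimension of its eigenspace;
-- algebraic and geometric multiplicity agree for the real symmetric
-- matrices to which this is applied.  It is a relation between λ′ and r
-- since the dimension cannot be computed from Cauchy sequences, and r = 0
-- says that λ′ is not an eigenvalue.

HasMultiplicity : ∀ {n} → Matrix n → ℝ → ℕ → Set
HasMultiplicity {n} A λ′ r = Σ (Vector (Vector ℝ n) r) (IsEigenbasis A λ′)

------------------------------------------------------------------------
-- Trees

record Graph (n : ℕ) : Set₁ where
  field
    Edge        : Rel (Fin n) 0ℓ
    edge?       : Decidable Edge
    symmetric   : Symmetric Edge
    irreflexive : Irreflexive _≡_ Edge

open Graph public using (Edge)

-- A cycle on 3 + m distinct vertices.

record Cycle {n} (G : Graph n) : Set where
  field
    {m}      : ℕ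
    vertex   : Fin (3 ℕ.+ m) → Fin n
    distinct : Injective _≡_ _≡_ vertex
    step     : ∀ i → Edge G (vertex (inject₁ i)) (vertex (suc i))
    close    : Edge G (vertex (fromℕ (2 ℕ.+ m))) (vertex zero)

record Tree (n : ℕ) : Set₁ where
  field
    graph     : Graph n
    nonEmpty  : ℕ.NonZero n
    connected : ∀ i j → Star (Edge graph) i j
    acyclic   : ¬ Cycle graph

open Tree public using (graph)

------------------------------------------------------------------------
-- k-NIM trees

-- A ∈𝒮 T leaves the diagonal of A unconstrained.

infix 4 _∈𝒮_

_∈𝒮_ : ∀ {n} → Matrix n → Tree n → Set
A ∈𝒮 T = IsSymmetric A × (∀ i j → i ≢ j → (A i j ≉ 0ℝ) ⇔ Edge (graph T) i j)

record IsMaxMultiplicity {n} (T : Tree n) (M : ℕ) : Set where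
  field
    attained : ∃[ A ] ∃[ λ′ ] A ∈𝒮 T × HasMultiplicity A λ′ M
    maximal  : ∀ A λ′ r → A ∈𝒮 T → HasMultiplicity A λ′ r → r ℕ.≤ M

-- The bound M - (k - 1) ≥ 2 is a requirement on T, not merely a premise of
-- `simple`.  As a premise it would make every tree with M = k vacuously
-- k-NIM: for instance the star with k + 1 leaves, for every k.

record _-NIM_ (k : ℕ) {n} (T : Tree n) : Set where
  field
    M        : ℕ
    isMax    : IsMaxMultiplicity T M
    k≤M      : k ℕ.≤ M
    multiple : 2 ℕ.≤ M ∸ (k ∸ 1)
    simple   : ∀ A λ′ → A ∈𝒮 T → HasMultiplicity A λ′ (M ∸ (k ∸ 1)) →
               ∀ μ → IsEigenvalue A μ → μ ≉ λ′ → HasMultiplicity A μ 1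

{-# OPTIONS --safe #-}

-- Let A ∈ 𝒮(T) have an eigenvalue κ of multiplicity M = M(T) ≥ 4.  Since an
-- eigenvector of a path is determined by two adjacent entries, T has a vertex v
-- with three neighbours uᵢ; let Bᵢ be the component of T − v containing uᵢ.  For
-- all but finitely many μ, changing only the diagonal entries at u₀, u₁ and u₂
-- makes μ an eigenvalue of each block A[Bᵢ], with an eigenvector xᵢ.  The xᵢ
-- satisfy the eigenvector equation for μ in every row but v, so μ gets
-- multiplicity at least 2 in A, while the multiplicity of κ drops by at most 3.
-- It can be lowered further in steps of exactly 1 without losing the xᵢ: given a
-- κ-eigenvector z with z_p ≠ 0, add a multiple of w wᵀ to A, where w is
-- orthogonal to each xᵢ but not to z, namely w = e_p if every xᵢ vanishes at p,
-- and otherwise w = x_p e_q − x_q e_p for some x = xᵢ with x_p ≠ 0 and a suitable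
-- neighbour q of p.  In this way κ reaches multiplicity M − (k − 1) ≤ M − 3.
--
-- The goal being a negation, any proposition may be decided finitely often under
-- a double negation; everything else, eigenbases in particular, is constructed.

module Submission where

open import Algebra.Bundles using (CommutativeRing)
import Algebra.Solver.Ring
open import Algebra.Solver.Ring.AlmostCommutativeRing
  using (fromCommutativeRing; _-Raw-AlmostCommutative⟶_)
open import Algebra.Structures using (IsGroup; IsRing)
open import Data.Empty using (⊥)
open import Data.Fin.Base using (Fin; zero; suc; fromℕ; inject₁; punchIn; punchOut; toℕ)
import Data.Fin.Properties as Fin
import Data.Integer.Base as ℤ
import Data.Integer.Properties as ℤ
open import Data.List.Base as List using (List; []; _∷_; length)
import Data.List.Properties as List
open import Data.List.Relation.Unary.All as All using (All; []; _∷_)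
import Data.List.Relation.Unary.All.Properties as All
open import Data.Maybe.Base using (Maybe; just; nothing)
open import Data.Nat.Base as ℕ using (ℕ; zero; suc; _≤_; _<_; z≤n; s≤s)
import Data.Nat.Coprimality as Coprimality
import Data.Nat.Properties as ℕ
open import Data.Product.Base using (∃; ∃-syntax; _×_; _,_; proj₁; proj₂)
open import Data.Rational.Base as ℚ using (ℚ; 0ℚ; 1ℚ; ½; ∣_∣; Positive)
import Data.Rational.Properties as ℚ
open import Data.Rational.Solver using () renaming (module +-*-Solver to ℚ-Solver)
open import Data.Sum.Base using (_⊎_; inj₁; inj₂; [_,_]′)
open import Data.Vec.Base as Vec using (lookup)
import Data.Vec.Membership.DecPropositional as VecMembership
open import Data.Vec.Membership.Propositional using (_∈_; _∉_)
open import Data.Vec.Membership.Propositional.Properties using (∈-lookup)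
open import Data.Vec.Functional using (Vector; removeAt; insertAt)
open import Data.Vec.Functional.Properties using (insertAt-lookup; insertAt-punchIn)
open import Data.Vec.Relation.Unary.Any using (here; there)
open import Defs using (Graph; Tree; Cycle; Edge; graph)
open import Function.Base using (_∘_; _⟨_⟩_; case_of_; id)
open import Function.Bundles using (_⇔_; mk⇔; Equivalence)
open import Function.Definitions using (Injective)
open import Level using (Level; 0ℓ)
open import Relation.Binary.Construct.Closure.ReflexiveTransitive as Star
  using (Star; _◅_; _◅◅_)
open import Relation.Binary.Core using (Rel)
open import Relation.Binary.PropositionalEquality as ≡ using (_≡_; _≢_)
open import Relation.Binary.Structures using (IsEquivalence)
open import Relation.Nullary.Decidable.Core
  using (Dec; yes; no; _×-dec_; ¬?; ¬¬-excluded-middle)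
open import Relation.Nullary.Negation using (¬_; contradiction)

-- Double negation

private variable
  ℓ ℓ′ : Level

infixl 1 _>>=_

_>>=_ : {A : Set ℓ} {B : Set ℓ′} → ¬ ¬ A → (A → ¬ ¬ B) → ¬ ¬ B
(m >>= f) k = m λ a → f a k

return : {A : Set ℓ} → A → ¬ ¬ A
return a k = k a

-- Double-negation shift, available constructively because the index set is finite.
¬¬-∀ : ∀ {n} {P : Fin n → Set ℓ} → (∀ i → ¬ ¬ P i) → ¬ ¬ (∀ i → P i)
¬¬-∀ {n = zero}  h = return λ ()
¬¬-∀ {n = suc n} h = do
  p  ← h zero
  ps ← ¬¬-∀ (h ∘ suc)
  return λ { zero → p ; (suc i) → ps i }

∀⊎∃ : ∀ {n} {P Q : Fin n → Set ℓ} → (∀ i → P i ⊎ Q i) → (∀ i → P i) ⊎ ∃ Q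
∀⊎∃ {n = zero}  h = inj₁ λ ()
∀⊎∃ {n = suc n} h with h zero | ∀⊎∃ (h ∘ suc)
... | inj₂ q | _            = inj₂ (zero , q)
... | inj₁ p | inj₂ (i , q) = inj₂ (suc i , q)
... | inj₁ p | inj₁ ps      = inj₁ λ { zero → p ; (suc i) → ps i }

-- Branches of a tree at a vertex

infixr 5 _∷⟨_⟩_

-- The vertices are kept as an index, so that `lookup` turns a path into the injective vertex map
-- that a `Cycle` asks for; ℓ counts edges.
data Path {n} (E : Rel (Fin n) 0ℓ) : ∀ {ℓ} → Fin n → Fin n → Vec.Vec (Fin n) (suc ℓ) → Set where
  [_]    : ∀ a → Path E a a Vec.[ a ]
  _∷⟨_⟩_ : ∀ {ℓ a b c} {xs : Vec.Vec (Fin n) (suc ℓ)} →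
           E a b → a ∉ xs → Path E b c xs → Path E a c (a Vec.∷ xs)

module _ {n} {E : Rel (Fin n) 0ℓ} where

  Path-suffix : ∀ {ℓ a b c} {xs : Vec.Vec (Fin n) (suc ℓ)} → Path E b c xs → a ∈ xs →
                ∃[ k ] ∃[ ys ] Path E {k} a c ys
  Path-suffix [ a ]             (here ≡.refl) = _ , _ , [ a ]
  Path-suffix π@(_ ∷⟨ _ ⟩ _)    (here ≡.refl) = _ , _ , π
  Path-suffix (_ ∷⟨ _ ⟩ π)      (there a∈xs)  = Path-suffix π a∈xs

  -- If the new first vertex already occurs on the shortened path, everything before that occurrence
  -- is dropped.
  loop-erase : ∀ {a c} → Star E a c → ∃[ k ] ∃[ ys ] Path E {k} a c ys
  loop-erase {a} Star.ε = _ , _ , [ a ]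
  loop-erase {a} (e ◅ es) with loop-erase es
  ... | k , ys , π with VecMembership._∈?_ Fin._≟_ a ys
  ...   | yes a∈ys = Path-suffix π a∈ys
  ...   | no  a∉ys = _ , _ , e ∷⟨ a∉ys ⟩ π

  Path-first : ∀ {ℓ a c} {xs : Vec.Vec (Fin n) (suc ℓ)} → Path E a c xs → lookup xs zero ≡ a
  Path-first [ _ ]          = ≡.refl
  Path-first (_ ∷⟨ _ ⟩ _)   = ≡.refl

  Path-last : ∀ {ℓ a c} {xs : Vec.Vec (Fin n) (suc ℓ)} → Path E a c xs →
              lookup xs (fromℕ ℓ) ≡ c
  Path-last [ _ ]          = ≡.refl
  Path-last (_ ∷⟨ _ ⟩ π)   = Path-last π

  Path-step : ∀ {ℓ a c} {xs : Vec.Vec (Fin n) (suc ℓ)} → Path E a c xs →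
              ∀ i → E (lookup xs (inject₁ i)) (lookup xs (suc i))
  Path-step (e ∷⟨ _ ⟩ π) zero    = ≡.subst (E _) (≡.sym (Path-first π)) e
  Path-step (_ ∷⟨ _ ⟩ π) (suc i) = Path-step π i

  Path-distinct : ∀ {ℓ a c} {xs : Vec.Vec (Fin n) (suc ℓ)} → Path E a c xs →
                  Injective _≡_ _≡_ (lookup xs)
  Path-distinct π                     {zero}  {zero}  eq = ≡.refl
  Path-distinct (_∷⟨_⟩_ {xs = xs} _ a∉xs π) {zero}  {suc j} eq =
    contradiction (≡.subst (_∈ xs) (≡.sym eq) (∈-lookup j xs)) a∉xs
  Path-distinct (_∷⟨_⟩_ {xs = xs} _ a∉xs π) {suc i} {zero}  eq =
    contradiction (≡.subst (_∈ xs) eq (∈-lookup i xs)) a∉xs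
  Path-distinct (_ ∷⟨ _ ⟩ π)          {suc i} {suc j} eq = ≡.cong suc (Path-distinct π eq)

module _ {n} (T : Tree n) where

  open Graph (graph T) using (edge?; symmetric; irreflexive)

  EdgeAvoiding : Fin n → Rel (Fin n) 0ℓ
  EdgeAvoiding v a b = Edge (graph T) a b × a ≢ v × b ≢ v

  -- For a neighbour u of v, the component of T − v that contains u.
  Branch : Fin n → Fin n → Fin n → Set
  Branch v u = Star (EdgeAvoiding v) u

  Branch-avoids : ∀ {v u p} → Edge (graph T) v u → Branch v u p → p ≢ v
  Branch-avoids v~u Star.ε ≡.refl = irreflexive ≡.refl v~u
  Branch-avoids v~u ((_ , _ , b≢v) ◅ es) = go b≢v es
    where
    go : ∀ {v b p} → b ≢ v → Branch v b p → p ≢ v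
    go b≢v Star.ε = b≢v
    go _ ((_ , _ , c≢v) ◅ es) = go c≢v es

  Branch-closed : ∀ {v u p q} → Edge (graph T) v u → Branch v u p → Edge (graph T) p q →
                  q ≡ v ⊎ Branch v u q
  Branch-closed {v} {q = q} v~u π p~q with q Fin.≟ v
  ... | yes q≡v = inj₁ q≡v
  ... | no  q≢v = inj₂ (π ◅◅ ((p~q , Branch-avoids v~u π , q≢v) ◅ Star.ε))

  private
    Path-avoids : ∀ {ℓ v a c} {xs : Vec.Vec (Fin n) (suc ℓ)} → Path (EdgeAvoiding v) a c xs →
                  a ≢ v → ∀ i → lookup xs i ≢ v
    Path-avoids [ _ ]                       a≢v zero    = a≢v
    Path-avoids (_ ∷⟨ _ ⟩ _)                a≢v zero    = a≢v
    Path-avoids ((_ , _ , b≢v) ∷⟨ _ ⟩ π)    a≢v (suc i) = Path-avoids π b≢v i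

  -- Joining the two walks at p and erasing loops gives a path from u to w that misses v. Unless it
  -- is trivial, v closes it to a cycle.
  Branch-disjoint : ∀ {v u w p} → Edge (graph T) v u → Edge (graph T) v w →
                    Branch v u p → Branch v w p → u ≡ w
  Branch-disjoint {v} {u} {w} v~u v~w u⇝p w⇝p
    with loop-erase (u⇝p ◅◅ Star.reverse (λ (e , a≢v , b≢v) → symmetric e , b≢v , a≢v) w⇝p)
  ... | zero  , _  , [ _ ] = ≡.refl
  -- The path has 2 + m vertices, so together with v there are 3 + m, the least number being that of
  -- a triangle.
  ... | suc m , xs , π     = contradiction cycle (Tree.acyclic T)
    where
    off-v : ∀ i → lookup xs i ≢ v
    off-v = Path-avoids π (Branch-avoids v~u Star.ε)
    distinct : Injective _≡_ _≡_ (lookup (v Vec.∷ xs))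
    distinct {zero}  {zero}  _  = ≡.refl
    distinct {zero}  {suc j} eq = contradiction (≡.sym eq) (off-v j)
    distinct {suc i} {zero}  eq = contradiction eq (off-v i)
    distinct {suc i} {suc j} eq = ≡.cong suc (Path-distinct π eq)
    cycle : Cycle (graph T)
    cycle = record
      { vertex   = lookup (v Vec.∷ xs)
      ; distinct = distinct
      ; step     = λ where
          zero    → ≡.subst (Edge (graph T) v) (≡.sym (Path-first π)) v~u
          (suc i) → proj₁ (Path-step π i)
      ; close    = ≡.subst (λ t → Edge (graph T) t v) (≡.sym (Path-last π)) (symmetric v~w)
      }

  -- Vertices of degree at least three

  record Fork : Set where
    field
      v           : Fin n
      u           : Fin 3 → Fin n
      u-injective : Injective _≡_ _≡_ u
      v~u         : ∀ i → Edge (graph T) v (u i)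

  private
    Claw : Fin n → Fin n → Fin n → Fin n → Set
    Claw v a b c = (Edge (graph T) v a × Edge (graph T) v b × Edge (graph T) v c) ×
                   (a ≢ b × b ≢ c × a ≢ c)

    Claw⇒Fork : ∀ {v a b c} → Claw v a b c → Fork
    Claw⇒Fork {v} {a} {b} {c} ((v~a , v~b , v~c) , (a≢b , b≢c , a≢c)) = record
      { v = v
      ; u = lookup abc
      ; u-injective = distinct
      ; v~u = λ where
          zero             → v~a
          (suc zero)       → v~b
          (suc (suc zero)) → v~c
      }
      where
      abc = a Vec.∷ b Vec.∷ c Vec.∷ Vec.[]
      distinct : Injective _≡_ _≡_ (lookup abc)
      distinct {zero}           {zero}           _  = ≡.refl
      distinct {zero}           {suc zero}       eq = contradiction eq a≢b
      distinct {zero}           {suc (suc zero)} eq = contradiction eq a≢c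
      distinct {suc zero}       {zero}           eq = contradiction (≡.sym eq) a≢b
      distinct {suc zero}       {suc zero}       _  = ≡.refl
      distinct {suc zero}       {suc (suc zero)} eq = contradiction eq b≢c
      distinct {suc (suc zero)} {zero}           eq = contradiction (≡.sym eq) a≢c
      distinct {suc (suc zero)} {suc zero}       eq = contradiction (≡.sym eq) b≢c
      distinct {suc (suc zero)} {suc (suc zero)} _  = ≡.refl

  -- The alternative says that all degrees are at most 2. Edges being decidable, a finite search
  -- settles the choice without double negation.
  fork-or-path : Fork ⊎ (∀ {v a b c} → Edge (graph T) v a → Edge (graph T) v b →
                         Edge (graph T) v c → a ≢ b → b ≢ c → a ≢ c → ⊥)
  fork-or-path with Fin.any? (λ v → Fin.any? λ a → Fin.any? λ b → Fin.any? λ c →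
                    (edge? v a ×-dec edge? v b ×-dec edge? v c) ×-dec
                    (¬? (a Fin.≟ b) ×-dec ¬? (b Fin.≟ c) ×-dec ¬? (a Fin.≟ c)))
  ... | yes (_ , _ , _ , _ , claw) = inj₁ (Claw⇒Fork claw)
  ... | no ¬claw = inj₂ λ v~a v~b v~c a≢b b≢c a≢c →
          ¬claw (_ , _ , _ , _ , (v~a , v~b , v~c) , (a≢b , b≢c , a≢c))

-- A field of characteristic 0 whose elements can be compared with 0 only up
-- to double negation.
record Field : Set₁ where
  field
    commutativeRing : CommutativeRing 0ℓ 0ℓ
  open CommutativeRing commutativeRing hiding (zero)
  field
    homomorphism : CommutativeRing.rawRing ℚ.+-*-commutativeRing
                   -Raw-AlmostCommutative⟶ fromCommutativeRing commutativeRing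
    zero-or-invertible : ∀ x → ¬ ¬ (x ≈ 0# ⊎ ∃[ y ] x * y ≈ 1#)
    1≉0 : ¬ (1# ≈ 0#)

-- Linear algebra over a field

module OverField (K : Field) where

  open Field K renaming (homomorphism to ℚ⟶K)
  open CommutativeRing commutativeRing hiding (zero)
  open import Algebra.Properties.Semiring.Sum semiring public
    using (sum; sum-cong-≋; sum-replicate-zero; sum-remove; ∑-distrib-+; ∑-comm;
           *-distribˡ-sum; *-distribʳ-sum)
  open import Algebra.Properties.Ring ring using (-0#≈0#; -‿distribˡ-*)
  open import Relation.Binary.Reasoning.Setoid setoid

  open _-Raw-AlmostCommutative⟶_ ℚ⟶K
    using (+-homo; *-homo; -‿homo; 1-homo) renaming (⟦_⟧ to ι)

  -- The ring solver must compare coefficients; equality in the field is not decidable, so the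
  -- coefficients are rationals.
  ι-≟ : ∀ p q → Maybe (ι p ≈ ι q)
  ι-≟ p q with p ℚ.≟ q
  ... | yes p≡q = just (reflexive (≡.cong ι p≡q))
  ... | no  _   = nothing

  module K-Solver = Algebra.Solver.Ring
    (CommutativeRing.rawRing ℚ.+-*-commutativeRing)
    (fromCommutativeRing commutativeRing) ℚ⟶K ι-≟

  -- The positive form of being nonzero: cancellation and the construction of bases need the inverse
  -- itself.
  Invertible : Carrier → Set
  Invertible x = ∃[ y ] x * y ≈ 1#

  Invertible-resp : ∀ {x y} → x ≈ y → Invertible x → Invertible y
  Invertible-resp x≈y (z , xz≈1) = z , trans (*-congʳ (sym x≈y)) xz≈1

  Invertible⇒≉0 : ∀ {x} → Invertible x → ¬ (x ≈ 0#)
  Invertible⇒≉0 (y , xy≈1) x≈0 = 1≉0 (trans (sym xy≈1) (trans (*-congʳ x≈0) (zeroˡ y)))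

  Invertible-* : ∀ {x y} → Invertible x → Invertible y → Invertible (x * y)
  Invertible-* {x} {y} (x′ , p) (y′ , q) = x′ * y′ , (begin
    x * y * (x′ * y′)    ≈⟨ solve 4 (λ x y x′ y′ → x :* y :* (x′ :* y′) := x :* x′ :* (y :* y′))
                              refl x y x′ y′ ⟩
    x * x′ * (y * y′)    ≈⟨ *-cong p q ⟩
    1# * 1#              ≈⟨ *-identityˡ 1# ⟩
    1#                   ∎)
    where open K-Solver

  cancelˡ : ∀ {x y} → Invertible x → x * y ≈ 0# → y ≈ 0#
  cancelˡ {x} {y} (z , xz≈1) xy≈0 = begin
    y            ≈⟨ *-identityˡ y ⟨
    1# * y       ≈⟨ *-congʳ xz≈1 ⟨
    x * z * y    ≈⟨ *-congʳ (*-comm x z) ⟩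
    z * x * y    ≈⟨ *-assoc z x y ⟩
    z * (x * y)  ≈⟨ *-congˡ xy≈0 ⟩
    z * 0#       ≈⟨ zeroʳ z ⟩
    0#           ∎

  x≈y⇒x-y≈0 : ∀ {x y} → x ≈ y → x - y ≈ 0#
  x≈y⇒x-y≈0 {x} {y} x≈y = trans (+-congʳ x≈y) (-‿inverseʳ y)

  x-y≈0⇒x≈y : ∀ {x y} → x - y ≈ 0# → x ≈ y
  x-y≈0⇒x≈y {x} {y} eq = begin
    x            ≈⟨ solve 2 (λ x y → x := x :- y :+ y) refl x y ⟩
    x - y + y    ≈⟨ +-congʳ eq ⟩
    0# + y       ≈⟨ +-identityˡ y ⟩
    y            ∎
    where open K-Solver

  -- Sums and vectors

  Vec : ℕ → Set
  Vec = Vector Carrier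

  IsZero : ∀ {n} → Vec n → Set
  IsZero z = ∀ i → z i ≈ 0#

  zero-or-invertible-coordinate : ∀ {n} (z : Vec n) →
                                  ¬ ¬ (IsZero z ⊎ ∃[ p ] Invertible (z p))
  zero-or-invertible-coordinate z = do
    h ← ¬¬-∀ λ i → zero-or-invertible (z i)
    return (∀⊎∃ h)

  sum-zero : ∀ {n} {t : Vec n} → IsZero t → sum t ≈ 0#
  sum-zero {n} {t} t≈0 = trans (sum-cong-≋ t≈0) (sum-replicate-zero n)

  sum-single : ∀ {n} i {t : Vec n} → (∀ j → j ≢ i → t j ≈ 0#) → sum t ≈ t i
  sum-single {suc n} i {t} t≈0 = begin
    sum t                        ≈⟨ sum-remove t ⟩
    t i + sum (removeAt t i)     ≈⟨ +-congˡ (sum-zero λ j → t≈0 (punchIn i j) (Fin.punchInᵢ≢i i j)) ⟩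
    t i + 0#                     ≈⟨ +-identityʳ (t i) ⟩
    t i                          ∎

  infix 8 _∙_

  _∙_ : ∀ {n} → Vec n → Vec n → Carrier
  f ∙ z = sum λ j → f j * z j

  ∙-cong : ∀ {n} {f g y z : Vec n} → (∀ i → f i ≈ g i) → (∀ i → y i ≈ z i) → f ∙ y ≈ g ∙ z
  ∙-cong p q = sum-cong-≋ λ i → *-cong (p i) (q i)

  ∙-congˡ : ∀ {n} (f : Vec n) {y z : Vec n} → (∀ i → y i ≈ z i) → f ∙ y ≈ f ∙ z
  ∙-congˡ f = ∙-cong {f = f} λ _ → refl

  ∙-comm : ∀ {n} (f z : Vec n) → f ∙ z ≈ z ∙ f
  ∙-comm f z = sum-cong-≋ λ i → *-comm (f i) (z i)

  ∙-distribʳ-+* : ∀ {n} (f g z : Vec n) t → (λ j → f j + t * g j) ∙ z ≈ f ∙ z + t * (g ∙ z)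
  ∙-distribʳ-+* f g z t = begin
    (λ j → f j + t * g j) ∙ z
      ≈⟨ sum-cong-≋ (λ j → solve 4 (λ f t g z → (f :+ t :* g) :* z := f :* z :+ t :* (g :* z))
           refl (f j) t (g j) (z j)) ⟩
    sum (λ j → f j * z j + t * (g j * z j))
      ≈⟨ ∑-distrib-+ (λ j → f j * z j) (λ j → t * (g j * z j)) ⟩
    f ∙ z + sum (λ j → t * (g j * z j))
      ≈⟨ +-congˡ (*-distribˡ-sum t (λ j → g j * z j)) ⟨
    f ∙ z + t * (g ∙ z) ∎
    where open K-Solver

  ∙-distribˡ-+* : ∀ {n} (z f g : Vec n) t → z ∙ (λ j → f j + t * g j) ≈ z ∙ f + t * (z ∙ g)
  ∙-distribˡ-+* z f g t = begin
    z ∙ (λ j → f j + t * g j)  ≈⟨ ∙-comm z _ ⟩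
    (λ j → f j + t * g j) ∙ z  ≈⟨ ∙-distribʳ-+* f g z t ⟩
    f ∙ z + t * (g ∙ z)        ≈⟨ +-cong (∙-comm f z) (*-congˡ (∙-comm g z)) ⟩
    z ∙ f + t * (z ∙ g)        ∎

  combination : ∀ {n r} → Vec r → Vector (Vec n) r → Vec n
  combination c b i = sum λ s → c s * b s i

  ∙-combination : ∀ {n r} (f : Vec n) (c : Vec r) (b : Vector (Vec n) r) →
                  f ∙ combination c b ≈ c ∙ λ s → f ∙ b s
  ∙-combination f c b = begin
    sum (λ j → f j * sum (λ s → c s * b s j))
      ≈⟨ sum-cong-≋ (λ j → *-distribˡ-sum (f j) (λ s → c s * b s j)) ⟩
    sum (λ j → sum λ s → f j * (c s * b s j))
      ≈⟨ ∑-comm (λ j s → f j * (c s * b s j)) ⟩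
    sum (λ s → sum λ j → f j * (c s * b s j))
      ≈⟨ sum-cong-≋ (λ s → trans
           (sum-cong-≋ λ j → solve 3 (λ f c b → f :* (c :* b) := c :* (f :* b)) refl (f j) (c s) (b s j))
           (sym (*-distribˡ-sum (c s) (λ j → f j * b s j)))) ⟩
    sum (λ s → c s * (f ∙ b s)) ∎
    where open K-Solver

  δ : ∀ {n} → Fin n → Vec n
  δ i j with i Fin.≟ j
  ... | yes _ = 1#
  ... | no  _ = 0#

  δ-diagonal : ∀ {n} (i : Fin n) → δ i i ≡ 1#
  δ-diagonal i with i Fin.≟ i
  ... | yes _  = ≡.refl
  ... | no i≢i = contradiction ≡.refl i≢i

  δ-off-diagonal : ∀ {n} {i j : Fin n} → j ≢ i → δ i j ≡ 0#
  δ-off-diagonal {i = i} {j} j≢i with i Fin.≟ j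
  ... | yes i≡j = contradiction (≡.sym i≡j) j≢i
  ... | no _    = ≡.refl

  δ-∙ : ∀ {n} i (z : Vec n) → δ i ∙ z ≈ z i
  δ-∙ i z = begin
    δ i ∙ z       ≈⟨ sum-single i (λ j j≢i → trans (*-congʳ (reflexive (δ-off-diagonal j≢i))) (zeroˡ (z j))) ⟩
    δ i i * z i   ≈⟨ *-congʳ (reflexive (δ-diagonal i)) ⟩
    1# * z i      ≈⟨ *-identityˡ (z i) ⟩
    z i           ∎

  combination-δ : ∀ {n} (c : Vec n) p → combination c δ p ≈ c p
  combination-δ c p = begin
    sum (λ s → c s * δ s p)
      ≈⟨ sum-single p (λ s s≢p → trans (*-congˡ (reflexive (δ-off-diagonal (s≢p ∘ ≡.sym)))) (zeroʳ (c s))) ⟩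
    c p * δ p p   ≈⟨ *-congˡ (reflexive (δ-diagonal p)) ⟩
    c p * 1#      ≈⟨ *-identityʳ (c p) ⟩
    c p           ∎

  -- Subspaces cut out by linear functionals, and their dimensions

  -- A subspace is given by its equations, so that further equations can be imposed one at a time
  -- while the dimension is tracked.
  Kernel : ∀ {n} → List (Vec n) → Vec n → Set
  Kernel F z = All (λ f → f ∙ z ≈ 0#) F

  record IsBasis {n r} (U : Vec n → Set) (b : Vector (Vec n) r) : Set where
    field
      members     : ∀ s → U (b s)
      independent : ∀ c → IsZero (combination c b) → IsZero c
      spanning    : ∀ v → U v → ∃[ c ] ∀ i → v i ≈ combination c b i

  open IsBasis public

  HasDimension : ∀ {n} → (Vec n → Set) → ℕ → Set
  HasDimension {n} U r = ∃[ b ] IsBasis {n} {r} U b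

  HasDimension-resp : ∀ {n r} {U V : Vec n → Set} → (∀ z → U z → V z) → (∀ z → V z → U z) →
                      HasDimension U r → HasDimension V r
  HasDimension-resp to from (b , basis) = b , record
    { members     = λ s → to (b s) (members basis s)
    ; independent = independent basis
    ; spanning    = λ v Vv → spanning basis v (from v Vv)
    }

  -- If `b s` were zero, the coefficients `δ s` would be a nontrivial relation.
  basis-nonzero : ∀ {n r U} {b : Vector (Vec n) r} → IsBasis U b → ∀ s →
                  ¬ ¬ (∃[ p ] Invertible (b s p))
  basis-nonzero {b = b} basis s = zero-or-invertible-coordinate (b s) >>= λ where
    (inj₁ b≈0) → contradiction
      (trans (sym (reflexive (δ-diagonal s))) (independent basis (δ s)
        (λ p → trans (δ-∙ s (λ t → b t p)) (b≈0 p)) s))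
      1≉0
    (inj₂ q) → return q

  HasDimension-full : ∀ {n} → HasDimension (Kernel {n} []) n
  HasDimension-full = δ , record
    { members     = λ _ → []
    ; independent = λ c z p → trans (sym (combination-δ c p)) (z p)
    ; spanning    = λ v _ → v , λ p → sym (combination-δ v p)
    }

  -- The basis vector b j on which f does not vanish is used to correct all
  -- the others.
  cut-invertible : ∀ {n r} {F : List (Vec n)} {b : Vector (Vec n) (suc r)} →
                   IsBasis (Kernel F) b → ∀ f j → Invertible (f ∙ b j) →
                   HasDimension (Kernel (f ∷ F)) r
  cut-invertible {n} {r} {F} {b} basis f j (y , gy≈1) = b′ , record
    { members     = λ s → vanishes s ∷ All.zipWith
        (λ {g} (p , q) → begin
          g ∙ b′ s
            ≈⟨ ∙-distribˡ-+* g (b (punchIn j s)) (b j) (t s) ⟩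
          g ∙ b (punchIn j s) + t s * (g ∙ b j)
            ≈⟨ +-cong p (*-congˡ q) ⟩
          0# + t s * 0#
            ≈⟨ trans (+-identityˡ _) (zeroʳ (t s)) ⟩
          0# ∎)
        (members basis (punchIn j s) , members basis j)
    ; independent = λ c c≈0 s → trans
        (reflexive (≡.sym (insertAt-punchIn c j (c ∙ t) s)))
        (independent basis (insertAt c j (c ∙ t))
          (λ p → trans (sym (combination-insertAt c p)) (c≈0 p)) (punchIn j s))
    ; spanning    = λ { v (fv≈0 ∷ Fv≈0) → span v fv≈0 (spanning basis v Fv≈0) }
    }
    where
    open K-Solver
    t : Vec r
    -- Solves f ∙ b′ s ≈ 0, where y is the inverse of f ∙ b j.
    t s = - ((f ∙ b (punchIn j s)) * y)
    b′ : Vector (Vec n) r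
    b′ s p = b (punchIn j s) p + t s * b j p
    vanishes : ∀ s → f ∙ b′ s ≈ 0#
    vanishes s = begin
      f ∙ b′ s
        ≈⟨ ∙-distribˡ-+* f (b (punchIn j s)) (b j) (t s) ⟩
      g + t s * (f ∙ b j)
        ≈⟨ solve 3 (λ g y h → g :+ (:- (g :* y)) :* h := g :- g :* (h :* y)) refl g y (f ∙ b j) ⟩
      g - g * (f ∙ b j * y)
        ≈⟨ x≈y⇒x-y≈0 (sym (trans (*-congˡ gy≈1) (*-identityʳ g))) ⟩
      0# ∎
      where g = f ∙ b (punchIn j s)
    combination-b′ : ∀ c p → combination c b′ p ≈
                     c ∙ t * b j p + combination c (removeAt b j) p
    combination-b′ c p = begin
      sum (λ s → c s * b′ s p)
        ≈⟨ sum-cong-≋ (λ s → solve 4 (λ c b t x → c :* (b :+ t :* x) := c :* t :* x :+ c :* b) refl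
             (c s) (b (punchIn j s) p) (t s) (b j p)) ⟩
      sum (λ s → c s * t s * b j p + c s * b (punchIn j s) p)
        ≈⟨ ∑-distrib-+ (λ s → c s * t s * b j p) (λ s → c s * b (punchIn j s) p) ⟩
      sum (λ s → c s * t s * b j p) + combination c (removeAt b j) p
        ≈⟨ +-congʳ (*-distribʳ-sum (b j p) (λ s → c s * t s)) ⟨
      c ∙ t * b j p + combination c (removeAt b j) p ∎
    combination-insertAt : ∀ c p → combination c b′ p ≈ combination (insertAt c j (c ∙ t)) b p
    combination-insertAt c p = begin
      combination c b′ p
        ≈⟨ combination-b′ c p ⟩
      c ∙ t * b j p + combination c (removeAt b j) p
        ≈⟨ +-cong (*-congʳ (reflexive (≡.sym (insertAt-lookup c j (c ∙ t)))))
             (sum-cong-≋ λ s → *-congʳ (reflexive (≡.sym (insertAt-punchIn c j (c ∙ t) s)))) ⟩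
      insertAt c j (c ∙ t) j * b j p
        + sum (λ s → insertAt c j (c ∙ t) (punchIn j s) * b (punchIn j s) p)
        ≈⟨ sum-remove {i = j} (λ s → insertAt c j (c ∙ t) s * b s p) ⟨
      combination (insertAt c j (c ∙ t)) b p ∎
    span : ∀ v → f ∙ v ≈ 0# → (∃[ c ] ∀ p → v p ≈ combination c b p) →
           ∃[ c ] ∀ p → v p ≈ combination c b′ p
    span v fv≈0 (c , v≈cb) = c′ , λ p → begin
      v p
        ≈⟨ v≈cb p ⟩
      combination c b p
        ≈⟨ sum-remove {i = j} (λ s → c s * b s p) ⟩
      c j * b j p + combination c′ (removeAt b j) p
        ≈⟨ +-congʳ (*-congʳ c′t≈cj) ⟨
      c′ ∙ t * b j p + combination c′ (removeAt b j) p
        ≈⟨ combination-b′ c′ p ⟨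
      combination c′ b′ p ∎
      where
      c′ = removeAt c j
      R = c′ ∙ λ s → f ∙ b (punchIn j s)
      -- Since f vanishes on v, the coordinate `c j` is determined by the others, and the
      -- corrections in b′ restore exactly this amount of b j.
      relation : c j * (f ∙ b j) + R ≈ 0#
      relation = begin
        c j * (f ∙ b j) + R          ≈⟨ sum-remove {i = j} (λ s → c s * (f ∙ b s)) ⟨
        (c ∙ λ s → f ∙ b s)          ≈⟨ ∙-combination f c b ⟨
        f ∙ combination c b          ≈⟨ ∙-congˡ f v≈cb ⟨
        f ∙ v                        ≈⟨ fv≈0 ⟩
        0#                           ∎
      c′t≈cj : c′ ∙ t ≈ c j
      c′t≈cj = begin
        c′ ∙ t
          ≈⟨ sum-cong-≋ (λ s → solve 3 (λ c g y → c :* (:- (g :* y)) := (c :* g) :* (:- y)) refl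
               (c′ s) (f ∙ b (punchIn j s)) y) ⟩
        sum (λ s → c′ s * (f ∙ b (punchIn j s)) * - y)
          ≈⟨ *-distribʳ-sum (- y) (λ s → c′ s * (f ∙ b (punchIn j s))) ⟨
        R * - y
          ≈⟨ solve 4 (λ R y c g → R :* (:- y) := c :* (g :* y) :- (c :* g :+ R) :* y) refl
               R y (c j) (f ∙ b j) ⟩
        c j * (f ∙ b j * y) - (c j * (f ∙ b j) + R) * y
          ≈⟨ +-cong (trans (*-congˡ gy≈1) (*-identityʳ (c j)))
               (-‿cong (trans (*-congʳ relation) (zeroˡ y))) ⟩
        c j - 0#
          ≈⟨ trans (+-congˡ -0#≈0#) (+-identityʳ (c j)) ⟩
        c j ∎

  -- Either f vanishes on the whole basis, which then stays a basis, or one basis vector is used up.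
  cut : ∀ {n r} {F : List (Vec n)} → HasDimension (Kernel F) r → ∀ f →
        ¬ ¬ (∃[ r′ ] r ≤ suc r′ × HasDimension (Kernel (f ∷ F)) r′)
  cut {r = r} (b , basis) f = zero-or-invertible-coordinate (λ s → f ∙ b s) >>= λ where
      (inj₁ fb≈0) → return (r , ℕ.n≤1+n r , b , record
        { members     = λ s → fb≈0 s ∷ members basis s
        ; independent = independent basis
        ; spanning    = λ { v (_ ∷ Fv≈0) → spanning basis v Fv≈0 }
        })
      (inj₂ (j , invertible)) → return (cut-at basis j invertible)
    where
    -- Generalised over r, so that the index j can force r to be a successor.
    cut-at : ∀ {r} {b : Vector _ r} → IsBasis _ b → ∀ j → Invertible (f ∙ b j) →
             ∃[ r′ ] r ≤ suc r′ × HasDimension _ r′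
    cut-at {suc r} basis j invertible = r , ℕ.≤-refl , cut-invertible basis f j invertible

  cut-all : ∀ {n r} {F : List (Vec n)} → HasDimension (Kernel F) r → ∀ G →
            ¬ ¬ (∃[ r′ ] r ≤ length G ℕ.+ r′ × HasDimension (Kernel (G List.++ F)) r′)
  cut-all {r = r} dim []      = return (r , ℕ.≤-refl , dim)
  cut-all         dim (g ∷ G) = do
    r₁ , r≤   , dim₁ ← cut-all dim G
    r₂ , r₁≤ , dim₂ ← cut dim₁ g
    return (r₂ , ℕ.≤-trans r≤ (ℕ.≤-trans (ℕ.+-monoʳ-≤ (length G) r₁≤)
                                (ℕ.≤-reflexive (ℕ.+-suc (length G) r₂))) , dim₂)

  -- Rank-nullity as an inequality: starting from the full space, each equation costs at most one
  -- dimension.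
  Kernel-dimension : ∀ {n} (F : List (Vec n)) →
                     ¬ ¬ (∃[ r ] n ≤ length F ℕ.+ r × HasDimension (Kernel F) r)
  Kernel-dimension {n} F = ≡.subst
    (λ F′ → ¬ ¬ (∃[ r ] n ≤ length F ℕ.+ r × HasDimension (Kernel F′) r))
    (List.++-identityʳ F) (cut-all HasDimension-full F)

  -- Nonzero solutions and comparison of dimensions

  Nonzero : ∀ {n} → Vec n → Set
  Nonzero z = ∃[ p ] Invertible (z p)

  nonzero-member : ∀ {n r} {U : Vec n → Set} → HasDimension U r → 1 ≤ r →
                   ¬ ¬ (∃[ z ] U z × Nonzero z)
  nonzero-member {r = suc r} (b , basis) _ = do
    nonzero ← basis-nonzero basis zero
    return (b zero , members basis zero , nonzero)

  underdetermined : ∀ {n} (F : List (Vec n)) → length F < n →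
                    ¬ ¬ (∃[ z ] Kernel F z × Nonzero z)
  underdetermined F F<n = do
    r , n≤ , dim ← Kernel-dimension F
    nonzero-member dim (ℕ.+-cancelˡ-≤ (length F) 1 r
      (ℕ.≤-trans (ℕ.≤-reflexive (ℕ.+-comm (length F) 1)) (ℕ.≤-trans F<n n≤)))

  -- The n coordinates of the combination are n linear equations in the m coefficients.
  dependent : ∀ {n m} (y : Vector (Vec n) m) → n < m →
              ¬ ¬ (∃[ a ] IsZero (combination a y) × Nonzero a)
  dependent {n} y n<m = do
    a , ya≈0 , nonzero ← underdetermined (List.tabulate λ p s → y s p)
      (≡.subst (_< _) (≡.sym (List.length-tabulate λ p s → y s p)) n<m)
    return (a , (λ p → trans (∙-comm a λ s → y s p) (All.tabulate⁻ ya≈0 p)) , nonzero)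

  -- If s exceeded t, the coordinate vectors of the b u with respect to d would be dependent, and
  -- the same relation would hold between the b u.
  dimension-mono : ∀ {n s t} {U V : Vec n → Set} → HasDimension U s → HasDimension V t →
                   (∀ z → U z → V z) → s ≤ t
  dimension-mono {s = s} {t} {U} {V} (b , b-basis) (d , d-basis) U⊆V with s ℕ.≤? t
  ... | yes s≤t = s≤t
  -- `id` refutes the empty type, so a doubly negated absurdity becomes an actual one. Having
  -- decided s ≤ t first is what allows the double negation to be left here.
  ... | no  s≰t = contradiction id (dependent C (ℕ.≰⇒> s≰t) >>= λ where
      (a , aC≈0 , p , aₚ⁻¹) → contradiction
        (independent b-basis a (λ i → begin
          sum (λ u → a u * b u i)
            ≈⟨ sum-cong-≋ (λ u → *-congˡ (b≈Cd u i)) ⟩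
          sum (λ u → a u * C u ∙ (λ k → d k i))
            ≈⟨ ∙-cong (λ _ → refl) (λ u → ∙-comm (C u) (λ k → d k i)) ⟩
          sum (λ u → a u * (λ k → d k i) ∙ C u)
            ≈⟨ ∙-combination (λ k → d k i) a C ⟨
          (λ k → d k i) ∙ combination a C
            ≈⟨ sum-zero (λ k → trans (*-congˡ (aC≈0 k)) (zeroʳ (d k i))) ⟩
          0# ∎) p)
        (Invertible⇒≉0 aₚ⁻¹))
    where
    C : Vector (Vec t) s
    C u = proj₁ (spanning d-basis (b u) (U⊆V (b u) (members b-basis u)))
    b≈Cd : ∀ u i → b u i ≈ combination (C u) d i
    b≈Cd u = proj₂ (spanning d-basis (b u) (U⊆V (b u) (members b-basis u)))

  -- Eigenvectors

  Matrix : ℕ → Set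
  Matrix n = Fin n → Vec n

  Eigenspace : ∀ {n} → Matrix n → Carrier → Vec n → Set
  Eigenspace A κ z = ∀ i → A i ∙ z ≈ κ * z i

  -- Row i of A - κI, which makes eigenspaces instances of `Kernel`.
  shifted-row : ∀ {n} → Matrix n → Carrier → Fin n → Vec n
  shifted-row A κ i j = A i j + - κ * δ i j

  shifted-row-∙ : ∀ {n} (A : Matrix n) κ i z → shifted-row A κ i ∙ z ≈ A i ∙ z - κ * z i
  shifted-row-∙ A κ i z = begin
    shifted-row A κ i ∙ z        ≈⟨ ∙-distribʳ-+* (A i) (δ i) z (- κ) ⟩
    A i ∙ z + - κ * δ i ∙ z      ≈⟨ +-congˡ (*-congˡ (δ-∙ i z)) ⟩
    A i ∙ z + - κ * z i          ≈⟨ +-congˡ (sym (-‿distribˡ-* κ (z i))) ⟩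
    A i ∙ z - κ * z i            ∎

  shifted-row≈0 : ∀ {n} (A : Matrix n) κ i z → A i ∙ z ≈ κ * z i → shifted-row A κ i ∙ z ≈ 0#
  shifted-row≈0 A κ i z eq = trans (shifted-row-∙ A κ i z) (x≈y⇒x-y≈0 eq)

  shifted-row≈0⁻¹ : ∀ {n} (A : Matrix n) κ i z → shifted-row A κ i ∙ z ≈ 0# → A i ∙ z ≈ κ * z i
  shifted-row≈0⁻¹ A κ i z eq = x-y≈0⇒x≈y (trans (sym (shifted-row-∙ A κ i z)) eq)

  shifted-rows : ∀ {n} → Matrix n → Carrier → List (Vec n)
  shifted-rows A κ = List.tabulate (shifted-row A κ)

  Eigenspace⇒Kernel : ∀ {n} (A : Matrix n) κ z → Eigenspace A κ z → Kernel (shifted-rows A κ) z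
  Eigenspace⇒Kernel A κ z eq = All.tabulate⁺ λ i → shifted-row≈0 A κ i z (eq i)

  Kernel⇒Eigenspace : ∀ {n} (A : Matrix n) κ z → Kernel (shifted-rows A κ) z → Eigenspace A κ z
  Kernel⇒Eigenspace A κ z eq i = shifted-row≈0⁻¹ A κ i z (All.tabulate⁻ eq i)

  -- Induction on m: applying A - κ₀I to the relation removes the first term and multiplies each
  -- other coefficient by the invertible κₛ - κ₀.
  distinct-eigenvectors-independent :
    ∀ {n m} (A : Matrix n) (κ : Vec m) (y : Vector (Vec n) m) →
    (∀ s → Eigenspace A (κ s) (y s)) →
    (∀ {s t} → s ≢ t → Invertible (κ s - κ t)) →
    ∀ a → IsZero (combination a y) → ∀ s p → a s * y s p ≈ 0#
  distinct-eigenvectors-independent {m = suc m} A κ y eigen distinct a ay≈0 = λ where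
      zero    p → begin
        a zero * y zero p
          ≈⟨ +-identityʳ _ ⟨
        a zero * y zero p + 0#
          ≈⟨ +-congˡ (sum-zero (λ s → rest s p)) ⟨
        combination a y p
          ≈⟨ ay≈0 p ⟩
        0# ∎
      (suc s) p → rest s p
    where
    open K-Solver
    a′ : Vec m
    a′ s = (κ (suc s) - κ zero) * a (suc s)
    scaled≈0 : IsZero (combination a′ (y ∘ suc))
    scaled≈0 p = begin
      combination a′ (y ∘ suc) p
        ≈⟨ +-identityˡ _ ⟨
      0# + combination a′ (y ∘ suc) p
        -- The term for index `zero` has the factor κ₀ - κ₀, so the sum may be extended to all
        -- indices.
        ≈⟨ +-congʳ (trans (*-congʳ (trans (*-congʳ (-‿inverseʳ (κ zero))) (zeroˡ (a zero)))) (zeroˡ (y zero p))) ⟨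
      sum (λ s → (κ s - κ zero) * a s * y s p)
        ≈⟨ sum-cong-≋ (λ s → solve 4 (λ k l a y → (k :- l) :* a :* y := a :* (k :* y) :+ (:- l) :* (a :* y))
             refl (κ s) (κ zero) (a s) (y s p)) ⟩
      sum (λ s → a s * (κ s * y s p) + - κ zero * (a s * y s p))
        ≈⟨ ∑-distrib-+ (λ s → a s * (κ s * y s p)) (λ s → - κ zero * (a s * y s p)) ⟩
      sum (λ s → a s * (κ s * y s p)) + sum (λ s → - κ zero * (a s * y s p))
        ≈⟨ +-cong (sum-cong-≋ (λ s → *-congˡ {x = a s} (eigen s p)))
             (*-distribˡ-sum (- κ zero) (λ s → a s * y s p)) ⟨
      sum (λ s → a s * A p ∙ y s) + - κ zero * combination a y p
        ≈⟨ +-cong (sym (∙-combination (A p) a y)) (trans (*-congˡ (ay≈0 p)) (zeroʳ _)) ⟩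
      A p ∙ combination a y + 0#
        ≈⟨ trans (+-identityʳ _) (sum-zero λ q → trans (*-congˡ (ay≈0 q)) (zeroʳ (A p q))) ⟩
      0# ∎
    rest : ∀ s p → a (suc s) * y (suc s) p ≈ 0#
    rest s p = cancelˡ (distinct {suc s} {zero} λ ())
      (trans (sym (*-assoc _ _ _))
        (distinct-eigenvectors-independent A (κ ∘ suc) (y ∘ suc) (eigen ∘ suc)
          (λ s≢t → distinct (s≢t ∘ Fin.suc-injective)) a′ scaled≈0 s p))

  -- Eigenvectors for n + 1 distinct values would be independent in a space of dimension n.
  non-eigenvalue : ∀ {n} (A : Matrix n) (κ : Vec (suc n)) →
    (∀ {s t} → s ≢ t → Invertible (κ s - κ t)) →
    ¬ ¬ (∃[ s ] ∀ y → Eigenspace A (κ s) y → ¬ Nonzero y)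
  non-eigenvalue {n} A κ distinct k = contradiction id (do
    y ← ¬¬-∀ {P = λ s → ∃[ y ] Eigenspace A (κ s) y × Nonzero y}
          λ s no → k (s , λ y eigen nonzero → no (y , eigen , nonzero))
    a , ay≈0 , s , aₛ⁻¹ ← dependent (proj₁ ∘ y) ℕ.≤-refl
    let yₛ , _ , p , yₛₚ⁻¹ = y s
    contradiction
      (distinct-eigenvectors-independent A κ (proj₁ ∘ y) (proj₁ ∘ proj₂ ∘ y) distinct a ay≈0 s p)
      (Invertible⇒≉0 (Invertible-* aₛ⁻¹ yₛₚ⁻¹)))

  -- Rational scalars

  ι-invertible : ∀ q → q ≢ ℚ.0ℚ → Invertible (ι q)
  ι-invertible q q≢0 = ι (ℚ.1/_ q {{ℚ.≢-nonZero q≢0}}) , (begin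
    ι q * ι (ℚ.1/_ q {{ℚ.≢-nonZero q≢0}})    ≈⟨ *-homo _ _ ⟨
    ι (q ℚ.* ℚ.1/_ q {{ℚ.≢-nonZero q≢0}})    ≈⟨ reflexive (≡.cong ι (ℚ.*-inverseʳ q {{ℚ.≢-nonZero q≢0}})) ⟩
    ι ℚ.1ℚ                                   ≈⟨ 1-homo ⟩
    1#                                       ∎)

  -- Written with the constructor, so that the numerator is k by computation.
  natural : ℕ → ℚ
  natural k = ℚ.mkℚ (ℤ.+ k) 0 (Coprimality.sym (Coprimality.1-coprimeTo k))

  ι-natural-difference : ∀ {k l} → k ≢ l → Invertible (ι (natural k) - ι (natural l))
  ι-natural-difference {k} {l} k≢l = Invertible-resp
    (trans (+-homo (natural k) (ℚ.- natural l)) (+-congˡ (-‿homo (natural l))))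
    (ι-invertible (natural k ℚ.- natural l) λ k-l≡0 →
      k≢l (ℤ.+-injective (≡.cong ℚ.numerator 
        (x∙y⁻¹≈ε⇒x≈y (natural k) (natural l) k-l≡0))))
    where open import Algebra.Properties.Group ℚ.+-0-group using (x∙y⁻¹≈ε⇒x≈y)

  -- Matrices of a tree

  -- Membership in 𝒮(T) in a form to compute with: an edge entry comes with its inverse, a non-edge
  -- entry with an equation.
  record Fits {n} (T : Tree n) (A : Matrix n) : Set where
    field
      symmetric : ∀ i j → A i j ≈ A j i
      edge      : ∀ {i j} → Edge (graph T) i j → Invertible (A i j)
      non-edge  : ∀ {i j} → i ≢ j → ¬ Edge (graph T) i j → A i j ≈ 0#

  -- An eigenvector that vanishes at two adjacent vertices of a path vanishes
  -- everywhere, so an eigenspace of dimension at least 3 rules out paths.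
  multiplicity≥3⇒Fork : ∀ {n} (T : Tree n) {A κ M} → Fits T A →
                        HasDimension (Eigenspace A κ) M → 3 ≤ M → ¬ ¬ Fork T
  multiplicity≥3⇒Fork {zero}  T fits dim 3≤M = contradiction (Tree.nonEmpty T) λ ()
  multiplicity≥3⇒Fork {suc n} T {A} {κ} {M} fits dim 3≤M with fork-or-path T
  ... | inj₁ fork = return fork
  ... | inj₂ path = case Fin.any? (edge? zero) of λ where
      (yes (q , 0~q)) → eigenvector zero q >>= λ (z , eigen , z₀≈0 , zq≈0 , nonzero) →
        all-zero z nonzero λ j →
          proj₁ (spread z eigen (Tree.connected T zero j) (z₀≈0 , q , 0~q , zq≈0))
      -- By connectedness the tree is then a single vertex, so vanishing at `zero` is vanishing
      -- everywhere.
      (no isolated)   → eigenvector zero zero >>= λ (z , eigen , z₀≈0 , _ , nonzero) →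
        all-zero z nonzero λ j → lone z z₀≈0 isolated (Tree.connected T zero j)
    where
    open Graph (graph T) using (edge?; irreflexive) renaming (symmetric to ~-sym)
    open Fits fits
    all-zero : ∀ z → Nonzero z → IsZero z → ¬ ¬ Fork T
    all-zero z (p , zₚ⁻¹) z≈0 = contradiction (z≈0 p) (Invertible⇒≉0 zₚ⁻¹)
    eigenvector : ∀ p q → ¬ ¬ (∃[ z ] Eigenspace A κ z × z p ≈ 0# × z q ≈ 0# × Nonzero z)
    eigenvector p q = do
      r , M≤ , dim′ ← cut-all (HasDimension-resp (Eigenspace⇒Kernel A κ) (Kernel⇒Eigenspace A κ) dim)
                        (δ p ∷ δ q ∷ [])
      z , δz≈0 ∷ δz≈0′ ∷ Fz≈0 , nonzero ←
        nonzero-member dim′ (ℕ.+-cancelˡ-≤ 2 1 r (ℕ.≤-trans 3≤M M≤))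
      return (z , Kernel⇒Eigenspace A κ z Fz≈0 , trans (sym (δ-∙ p z)) δz≈0 ,
              trans (sym (δ-∙ q z)) δz≈0′ , nonzero)
    lone : ∀ z → z zero ≈ 0# → ¬ ∃ (Edge (graph T) zero) → ∀ {j} →
           Star (Edge (graph T)) zero j → z j ≈ 0#
    lone z z₀≈0 isolated Star.ε       = z₀≈0
    lone z z₀≈0 isolated (e ◅ _) = contradiction (_ , e) isolated
    Q : Vec (suc n) → Fin (suc n) → Set
    Q z a = z a ≈ 0# × ∃[ b ] Edge (graph T) a b × z b ≈ 0#
    -- With z zero at a and at its neighbour b, and no third neighbour present, row a of the
    -- eigenvector equation reduces to the term at c.
    step : ∀ z → Eigenspace A κ z → ∀ {a c} → Edge (graph T) a c → Q z a → Q z c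
    step z eigen {a} {c} a~c (zₐ≈0 , b , a~b , z_b≈0) = z_c≈0 (b Fin.≟ c) , a , ~-sym a~c , zₐ≈0
      where
      others : b ≢ c → ∀ j → j ≢ c → A a j * z j ≈ 0#
      others b≢c j j≢c with j Fin.≟ a | j Fin.≟ b | edge? a j
      ... | yes ≡.refl | _          | _       = trans (*-congˡ zₐ≈0) (zeroʳ _)
      ... | no _       | yes ≡.refl | _       = trans (*-congˡ z_b≈0) (zeroʳ _)
      ... | no j≢a     | no _       | no a≁j  =
        trans (*-congʳ (non-edge (j≢a ∘ ≡.sym) a≁j)) (zeroˡ _)
      ... | no _       | no j≢b     | yes a~j =
        contradiction b≢c (λ b≢c → path a~b a~c a~j b≢c (j≢c ∘ ≡.sym) (j≢b ∘ ≡.sym))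
      z_c≈0 : Dec (b ≡ c) → z c ≈ 0#
      z_c≈0 (yes ≡.refl) = z_b≈0
      z_c≈0 (no b≢c) = cancelˡ (edge a~c) (begin
        A a c * z c  ≈⟨ sum-single c (others b≢c) ⟨
        A a ∙ z      ≈⟨ eigen a ⟩
        κ * z a      ≈⟨ *-congˡ zₐ≈0 ⟩
        κ * 0#       ≈⟨ zeroʳ κ ⟩
        0#           ∎)
    spread : ∀ z → Eigenspace A κ z → ∀ {a c} → Star (Edge (graph T)) a c → Q z a → Q z c
    spread z eigen Star.ε        q = q
    spread z eigen (e ◅ es) q = spread z eigen es (step z eigen e q)

  all-but-one : ∀ {n} (w : Fin n) (f : Fin n → Vec n) →
                ¬ ¬ (∃[ z ] (∀ p → p ≢ w → f p ∙ z ≈ 0#) × Nonzero z)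
  all-but-one {suc n} w f = do
    z , fz≈0 , nonzero ← underdetermined (List.tabulate (f ∘ punchIn w))
      (s≤s (ℕ.≤-reflexive (List.length-tabulate (f ∘ punchIn w))))
    return (z , (λ p p≢w → ≡.subst (λ t → f t ∙ z ≈ 0#) (Fin.punchIn-punchOut (p≢w ∘ ≡.sym))
                             (All.tabulate⁻ fz≈0 (punchOut (p≢w ∘ ≡.sym)))) , nonzero)

  -- Spiders: partial eigenvectors on three branches

  module _ {n} (T : Tree n) (F : Fork T) where

    open Fork F
    open Graph (graph T) using (edge?; irreflexive) renaming (symmetric to ~-sym)

    Leg : Fin 3 → Fin n → Set
    Leg i = Branch T v (u i)

    Leg-root : ∀ i → Leg i (u i)
    Leg-root i = Star.ε

    Leg-avoids : ∀ {i p} → Leg i p → p ≢ v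
    Leg-avoids {i} = Branch-avoids T (v~u i)

    Leg-disjoint : ∀ {i j p} → Leg i p → Leg j p → i ≡ j
    Leg-disjoint {i} {j} a b = u-injective (Branch-disjoint T (v~u i) (v~u j) a b)

    Leg-closed : ∀ {i p q} → Leg i p → Edge (graph T) p q → q ≡ v ⊎ Leg i q
    Leg-closed {i} = Branch-closed T (v~u i)

    -- Three μ-eigenvectors of A except for the row v, one on each branch:
    -- they span an at least 2-dimensional space of true eigenvectors.
    record Spider (A : Matrix n) (μ : Carrier) : Set where
      field
        x       : Fin 3 → Vec n
        support : ∀ {i p} → ¬ Leg i p → x i p ≈ 0#
        root    : ∀ i → Invertible (x i (u i))
        eigen   : ∀ i {p} → p ≢ v → A p ∙ x i ≈ μ * x i p

    -- Reachability in T - v is taken as decided; `intermediate-multiplicity` supplies this by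
    -- excluded middle under a double negation.
    module _ (Leg? : ∀ i p → Dec (Leg i p)) where

      -- A vertex off the branch and different from v has no neighbour on the branch.
      outside-row : ∀ {A} → Fits T A → ∀ {z i} → (∀ {p} → ¬ Leg i p → z p ≈ 0#) →
                    ∀ {p} → ¬ Leg i p → p ≢ v → A p ∙ z ≈ 0#
      outside-row {A} fits {z} {i} support {p} p∉ p≢v = sum-zero term
        where
        open Fits fits
        term : ∀ q → A p q * z q ≈ 0#
        term q with Leg? i q | edge? p q
        ... | no q∉  | _       = trans (*-congˡ (support q∉)) (zeroʳ _)
        ... | yes q∈ | no p≁q  = trans (*-congʳ (non-edge (λ { ≡.refl → p∉ q∈ }) p≁q)) (zeroˡ _)
        ... | yes q∈ | yes p~q with Leg-closed q∈ (~-sym p~q)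
        ...   | inj₁ p≡v = contradiction p≡v p≢v
        ...   | inj₂ p∈  = contradiction p∈ p∉

      -- If μ is not an eigenvalue of the principal submatrix of A obtained by
      -- deleting v and the roots, then each branch carries a vector that violates
      -- the eigenvector equation at the root only and does not vanish there; a
      -- change of the diagonal entry at the root then repairs the equation.
      grow-spider : ∀ {A} κ → Fits T A →
        ¬ ¬ (∃[ A′ ] ∃[ μ ] Fits T A′ × Invertible (μ - κ) × Spider A′ μ ×
             (∀ z → Eigenspace A κ z → (∀ i → z (u i) ≈ 0#) → Eigenspace A′ κ z))
      grow-spider {A} κ fits = do
        s , μ-regular ← non-eigenvalue masked candidate candidate-distinct
        legs ← ¬¬-∀ (leg-vector (candidate s) μ-regular)
        return (spider (candidate s) (candidate-invertible s) legs)
        where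
        open Fits fits
        open K-Solver

        root? : ∀ p → Dec (∃[ i ] u i ≡ p)
        root? p = Fin.any? λ i → u i Fin.≟ p

        -- Rows are zeroed instead of deleted: a vector vanishing at v and at the roots satisfies
        -- the zero rows for every μ.
        masked : Matrix n
        masked p with p Fin.≟ v | root? p
        ... | no _ | no _ = A p
        ... | _    | _    = λ _ → 0#

        masked-eigenvector : ∀ {μ z} → z v ≈ 0# → (∀ i → z (u i) ≈ 0#) →
          (∀ {p} → p ≢ v → (∀ i → p ≢ u i) → A p ∙ z ≈ μ * z p) → Eigenspace masked μ z
        masked-eigenvector {μ} {z} zᵥ≈0 zᵤ≈0 eigen p with p Fin.≟ v | root? p
        ... | no p≢v     | no p≢u           = eigen p≢v λ i p≡u → p≢u (i , ≡.sym p≡u)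
        ... | yes ≡.refl | _                = trans (sum-zero λ j → zeroˡ (z j))
                                                (sym (trans (*-congˡ zᵥ≈0) (zeroʳ μ)))
        ... | no _       | yes (i , ≡.refl) = trans (sum-zero λ j → zeroˡ (z j))
                                                (sym (trans (*-congˡ (zᵤ≈0 i)) (zeroʳ μ)))

        -- The n + 1 values κ + 1, κ + 2, and so on. The shift by one keeps κ out, and subtracting
        -- the image of 0 brings the differences into the form of `ι-natural-difference`.
        candidate : Vec (suc n)
        candidate s = κ + (ι (natural (suc (toℕ s))) - ι (natural 0))

        candidate-invertible : ∀ s → Invertible (candidate s - κ)
        candidate-invertible s = Invertible-resp
          (solve 2 (λ q k → q := k :+ q :- k) refl _ κ)
          (ι-natural-difference {suc (toℕ s)} {0} λ ())

        candidate-distinct : ∀ {s t} → s ≢ t → Invertible (candidate s - candidate t)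
        candidate-distinct {s} {t} s≢t = Invertible-resp
          (solve 4 (λ a b z k → a :- b := k :+ (a :- z) :- (k :+ (b :- z))) refl _ _ (ι (natural 0)) κ)
          (ι-natural-difference (s≢t ∘ Fin.toℕ-injective ∘ ℕ.suc-injective))

        -- One equation for each vertex but the root: the row of A - μI on the branch, vanishing off
        -- it. A nonzero solution vanishing at the root too would be a μ-eigenvector of `masked`.
        leg-vector : ∀ μ → (∀ z → Eigenspace masked μ z → ¬ Nonzero z) → ∀ i →
          ¬ ¬ (∃[ z ] (∀ p → ¬ Leg i p → z p ≈ 0#) × Invertible (z (u i)) ×
                      (∀ p → Leg i p → p ≢ u i → A p ∙ z ≈ μ * z p))
        leg-vector μ regular i = do
          z , fz≈0 , nonzero ← all-but-one (u i) f
          zero-or-invertible (z (u i)) >>= λ where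
            (inj₁ zᵤ≈0) → contradiction nonzero
              (regular z (masked-eigenvector
                (outside z fz≈0 λ v∈ → Leg-avoids v∈ ≡.refl)
                (λ j → case j Fin.≟ i of λ where
                  (yes ≡.refl) → zᵤ≈0
                  (no j≢i) → outside z fz≈0 λ uⱼ∈ → j≢i (Leg-disjoint (Leg-root j) uⱼ∈))
                (λ {p} p≢v p≢u → case Leg? i p of λ where
                  (yes p∈) → inside z fz≈0 p∈ (p≢u i)
                  (no p∉)  → trans (outside-row fits (outside z fz≈0) p∉ p≢v)
                               (sym (trans (*-congˡ (outside z fz≈0 p∉)) (zeroʳ μ))))))
            (inj₂ zᵤ⁻¹) → return
              (z , (λ p → outside z fz≈0 {p}) , zᵤ⁻¹ , λ p → inside z fz≈0 {p})
          where
          f : Fin n → Vec n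
          f p = case Leg? i p of λ where
            (yes _) → shifted-row A μ p
            (no _)  → δ p
          outside : ∀ z → (∀ p → p ≢ u i → f p ∙ z ≈ 0#) → ∀ {p} → ¬ Leg i p → z p ≈ 0#
          outside z fz≈0 {p} p∉ with Leg? i p | fz≈0 p (λ { ≡.refl → p∉ (Leg-root i) })
          ... | yes p∈ | _  = contradiction p∈ p∉
          ... | no _   | eq = trans (sym (δ-∙ p z)) eq
          inside : ∀ z → (∀ p → p ≢ u i → f p ∙ z ≈ 0#) → ∀ {p} → Leg i p → p ≢ u i →
                   A p ∙ z ≈ μ * z p
          inside z fz≈0 {p} p∈ p≢u with Leg? i p | fz≈0 p p≢u
          ... | no p∉ | _  = contradiction p∈ p∉
          ... | yes _ | eq = shifted-row≈0⁻¹ A μ p z eq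

        spider : ∀ μ → Invertible (μ - κ) →
          (∀ i → ∃[ z ] (∀ p → ¬ Leg i p → z p ≈ 0#) × Invertible (z (u i)) ×
                        (∀ p → Leg i p → p ≢ u i → A p ∙ z ≈ μ * z p)) →
          ∃[ A′ ] ∃[ μ ] Fits T A′ × Invertible (μ - κ) × Spider A′ μ ×
             (∀ z → Eigenspace A κ z → (∀ i → z (u i) ≈ 0#) → Eigenspace A′ κ z)
        spider μ μ-κ legs = A′ , μ , fits′ , μ-κ , record
          { x       = x
          ; support = λ {i} → support i
          ; root    = root
          ; eigen   = λ i {p} p≢v → trans (A′-∙ p (x i)) (eigen′ i p p≢v)
          -- The changed diagonal entries are multiplied only by zeros of z.
          } , λ z eigen zᵤ≈0 p → begin
            A′ p ∙ z              ≈⟨ A′-∙ p z ⟩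
            A p ∙ z + d p * z p   ≈⟨ +-cong (eigen p) (d-vanishes z zᵤ≈0 p) ⟩
            κ * z p + 0#          ≈⟨ +-identityʳ _ ⟩
            κ * z p               ∎
          where
          x : Fin 3 → Vec n
          x i = proj₁ (legs i)
          support : ∀ i {p} → ¬ Leg i p → x i p ≈ 0#
          support i {p} = proj₁ (proj₂ (legs i)) p
          root : ∀ i → Invertible (x i (u i))
          root i = proj₁ (proj₂ (proj₂ (legs i)))
          inner : ∀ i {p} → Leg i p → p ≢ u i → A p ∙ x i ≈ μ * x i p
          inner i {p} = proj₂ (proj₂ (proj₂ (legs i))) p
          -- The defect of `x i` at its root divided by its value there: adding this to the diagonal
          -- entry repairs the row.
          c : Fin 3 → Carrier
          c i = (μ * x i (u i) - A (u i) ∙ x i) * proj₁ (root i)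
          d : Vec n
          d p with root? p
          ... | yes (i , _) = c i
          ... | no _        = 0#
          d-root : ∀ i → d (u i) ≡ c i
          d-root i with root? (u i)
          ... | yes (j , uⱼ≡uᵢ) = ≡.cong c (u-injective uⱼ≡uᵢ)
          ... | no ¬root        = contradiction (i , ≡.refl) ¬root
          d-vanishes : ∀ z → (∀ i → z (u i) ≈ 0#) → ∀ p → d p * z p ≈ 0#
          d-vanishes z zᵤ≈0 p with root? p
          ... | yes (i , ≡.refl) = trans (*-congˡ (zᵤ≈0 i)) (zeroʳ _)
          ... | no _             = zeroˡ _
          A′ : Matrix n
          A′ p q = A p q + d p * δ p q
          A′-∙ : ∀ p z → A′ p ∙ z ≈ A p ∙ z + d p * z p
          A′-∙ p z = trans (∙-distribʳ-+* (A p) (δ p) z (d p)) (+-congˡ (*-congˡ (δ-∙ p z)))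
          off-diagonal : ∀ {p q} → p ≢ q → A′ p q ≈ A p q
          off-diagonal {p} {q} p≢q = begin
            A p q + d p * δ p q  ≈⟨ +-congˡ (*-congˡ (reflexive (δ-off-diagonal (p≢q ∘ ≡.sym)))) ⟩
            A p q + d p * 0#     ≈⟨ +-congˡ (zeroʳ (d p)) ⟩
            A p q + 0#           ≈⟨ +-identityʳ (A p q) ⟩
            A p q                ∎
          fits′ : Fits T A′
          fits′ = record
            { symmetric = λ p q → case p Fin.≟ q of λ where
                (yes ≡.refl) → refl
                (no p≢q)     → trans (off-diagonal p≢q)
                                 (trans (symmetric p q) (sym (off-diagonal (p≢q ∘ ≡.sym))))
            ; edge      = λ {p} {q} p~q → Invertible-resp
                (sym (off-diagonal λ p≡q → irreflexive p≡q p~q)) (edge p~q)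
            ; non-edge  = λ p≢q p≁q → trans (off-diagonal p≢q) (non-edge p≢q p≁q)
            }
          eigen′ : ∀ i p → p ≢ v → A p ∙ x i + d p * x i p ≈ μ * x i p
          eigen′ i p p≢v with p Fin.≟ u i
          ... | yes ≡.refl = begin
            A p ∙ x i + d p * x i p
              ≈⟨ +-congˡ (*-congʳ (reflexive (d-root i))) ⟩
            A p ∙ x i + (μ * x i p - A p ∙ x i) * y * x i p
              ≈⟨ solve 4 (λ a m y x → a :+ (m :- a) :* y :* x := a :+ (m :- a) :* (x :* y))
                   refl (A p ∙ x i) (μ * x i p) y (x i p) ⟩
            A p ∙ x i + (μ * x i p - A p ∙ x i) * (x i p * y)
              ≈⟨ +-congˡ (trans (*-congˡ (proj₂ (root i))) (*-identityʳ _)) ⟩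
            A p ∙ x i + (μ * x i p - A p ∙ x i)
              ≈⟨ solve 2 (λ a m → a :+ (m :- a) := m) refl (A p ∙ x i) (μ * x i p) ⟩
            μ * x i p ∎
            where y = proj₁ (root i)
          ... | no p≢u = trans (+-cong row (diagonal (root? p))) (+-identityʳ _)
            where
            row : A p ∙ x i ≈ μ * x i p
            row with Leg? i p
            ... | yes p∈ = inner i p∈ p≢u
            ... | no p∉  = trans (outside-row fits (support i) p∉ p≢v)
                             (sym (trans (*-congˡ (support i p∉)) (zeroʳ μ)))
            diagonal : Dec (∃[ j ] u j ≡ p) → d p * x i p ≈ 0#
            -- The diagonal is changed at the other roots as well, but they lie on other branches,
            -- where `x i` vanishes.
            diagonal (yes (j , ≡.refl)) = trans
              (*-congˡ (support i λ uⱼ∈ → p≢u (≡.cong u (Leg-disjoint (Leg-root j) uⱼ∈)))) (zeroʳ _)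
            diagonal (no ¬root) with root? p
            ... | yes r = contradiction r ¬root
            ... | no _  = zeroˡ _

  -- Rank-one perturbations

  self-adjoint : ∀ {n} {A : Matrix n} → (∀ i j → A i j ≈ A j i) → ∀ y z →
                 y ∙ (λ p → A p ∙ z) ≈ (λ p → A p ∙ y) ∙ z
  self-adjoint {A = A} symmetric y z = begin
    sum (λ p → y p * sum (λ q → A p q * z q))
      ≈⟨ sum-cong-≋ (λ p → *-distribˡ-sum (y p) (λ q → A p q * z q)) ⟩
    sum (λ p → sum λ q → y p * (A p q * z q))
      ≈⟨ ∑-comm (λ p q → y p * (A p q * z q)) ⟩
    sum (λ q → sum λ p → y p * (A p q * z q))
      ≈⟨ sum-cong-≋ (λ q → trans
           (sum-cong-≋ λ p → trans
             (solve 3 (λ y a z → y :* (a :* z) := a :* y :* z) refl (y p) (A p q) (z q))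
             (*-congʳ (*-congʳ (symmetric p q))))
           (sym (*-distribʳ-sum (z q) (λ p → A q p * y p)))) ⟩
    sum (λ q → (A q ∙ y) * z q) ∎
    where open K-Solver

  perturb : ∀ {n} → Matrix n → Carrier → Vec n → Matrix n
  perturb A c w p q = A p q + c * w p * w q

  perturb-∙ : ∀ {n} (A : Matrix n) c w p z → perturb A c w p ∙ z ≈ A p ∙ z + c * w p * w ∙ z
  perturb-∙ A c w p z = ∙-distribʳ-+* (A p) w z (c * w p)

  perturb-fixes : ∀ {n} (A : Matrix n) c w z → w ∙ z ≈ 0# → ∀ p → perturb A c w p ∙ z ≈ A p ∙ z
  perturb-fixes A c w z w∙z≈0 p = begin
    perturb A c w p ∙ z         ≈⟨ perturb-∙ A c w p z ⟩
    A p ∙ z + c * w p * w ∙ z   ≈⟨ +-congˡ (trans (*-congˡ w∙z≈0) (zeroʳ (c * w p))) ⟩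
    A p ∙ z + 0#                ≈⟨ +-identityʳ (A p ∙ z) ⟩
    A p ∙ z                     ∎

  -- Pairing the eigenvector equation of the perturbed matrix with y shows that
  -- its κ-eigenvectors are orthogonal to w.
  perturb-orthogonal : ∀ {n} (A : Matrix n) κ c w {y z} → (∀ i j → A i j ≈ A j i) →
    Invertible c → Eigenspace A κ y → Invertible (w ∙ y) → Eigenspace (perturb A c w) κ z →
    w ∙ z ≈ 0#
  perturb-orthogonal A κ c w {y} {z} symmetric c⁻¹ y-eigen wy⁻¹ z-eigen =
    cancelˡ (Invertible-* c⁻¹ wy⁻¹) (begin
      c * w ∙ y * w ∙ z
        ≈⟨ solve 4 (λ c a b m → c :* a :* b := m :+ c :* b :* a :- m) refl
             c (w ∙ y) (w ∙ z) (y ∙ (λ p → A p ∙ z)) ⟩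
      y ∙ (λ p → A p ∙ z) + c * w ∙ z * w ∙ y - y ∙ (λ p → A p ∙ z)
        -- By symmetry of A both sides equal κ times y ∙ z, so their difference, the rank-one term,
        -- is zero.
        ≈⟨ x≈y⇒x-y≈0 (begin
          y ∙ (λ p → A p ∙ z) + c * w ∙ z * w ∙ y
            ≈⟨ +-congˡ (*-congˡ (∙-comm w y)) ⟩
          y ∙ (λ p → A p ∙ z) + c * w ∙ z * y ∙ w
            ≈⟨ ∙-distribˡ-+* y (λ p → A p ∙ z) w (c * w ∙ z) ⟨
          y ∙ (λ p → A p ∙ z + c * w ∙ z * w p)
            ≈⟨ ∙-congˡ y (λ p → begin
              A p ∙ z + c * w ∙ z * w p
                ≈⟨ +-congˡ (solve 3 (λ c b w → c :* b :* w := c :* w :* b) refl c (w ∙ z) (w p)) ⟩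
              A p ∙ z + c * w p * w ∙ z
                ≈⟨ perturb-∙ A c w p z ⟨
              perturb A c w p ∙ z
                ≈⟨ z-eigen p ⟩
              κ * z p ∎) ⟩
          y ∙ (λ p → κ * z p)
            ≈⟨ sum-cong-≋ (λ p → solve 3 (λ y k z → y :* (k :* z) := k :* y :* z) refl (y p) κ (z p)) ⟩
          (λ p → κ * y p) ∙ z
            ≈⟨ ∙-cong {y = z} y-eigen (λ _ → refl) ⟨
          (λ p → A p ∙ y) ∙ z
            ≈⟨ self-adjoint symmetric y z ⟨
          y ∙ (λ p → A p ∙ z) ∎) ⟩
      0# ∎)
    where open K-Solver

  -- The new κ-eigenspace is the old one cut by the equation w ∙ z ≈ 0, and this equation fails on
  -- `b zero`, so exactly one dimension is lost.
  perturb-dimension : ∀ {n r} (A : Matrix n) κ c w {b : Vector (Vec n) (suc r)} →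
    (∀ i j → A i j ≈ A j i) → Invertible c → IsBasis (Eigenspace A κ) b →
    Invertible (w ∙ b zero) → HasDimension (Eigenspace (perturb A c w) κ) r
  perturb-dimension A κ c w {b} symmetric c⁻¹ basis wb⁻¹ = HasDimension-resp
    (λ { z (wz≈0 ∷ Fz≈0) p → trans (perturb-fixes A c w z wz≈0 p) (Kernel⇒Eigenspace A κ z Fz≈0 p) })
    (λ z z-eigen →
      let wz≈0 = perturb-orthogonal A κ c w symmetric c⁻¹ (members basis zero) wb⁻¹ z-eigen
      in wz≈0 ∷ Eigenspace⇒Kernel A κ z
           (λ p → trans (sym (perturb-fixes A c w z wz≈0 p)) (z-eigen p)))
    (cut-invertible {F = shifted-rows A κ}
      (proj₂ (HasDimension-resp (Eigenspace⇒Kernel A κ) (Kernel⇒Eigenspace A κ) (b , basis)))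
      w zero wb⁻¹)

  perturb-fits : ∀ {n} {T : Tree n} {A c w} → Fits T A →
    (∀ {p q} → p ≢ q → ¬ Edge (graph T) p q → w p * w q ≈ 0#) →
    (∀ {p q} → Edge (graph T) p q → Invertible (perturb A c w p q)) → Fits T (perturb A c w)
  perturb-fits {A = A} {c} {w} fits supported edges = record
    { symmetric = λ p q → +-cong (Fits.symmetric fits p q)
        (solve 3 (λ c a b → c :* a :* b := c :* b :* a) refl c (w p) (w q))
    ; edge      = edges
    ; non-edge  = λ {p} {q} p≢q p≁q → begin
        A p q + c * w p * w q    ≈⟨ +-cong (Fits.non-edge fits p≢q p≁q) (*-assoc c (w p) (w q)) ⟩
        0# + c * (w p * w q)     ≈⟨ +-identityˡ _ ⟩
        c * (w p * w q)          ≈⟨ *-congˡ (supported p≢q p≁q) ⟩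
        c * 0#                   ≈⟨ zeroʳ c ⟩
        0#                       ∎
    }
    where open K-Solver

  -- Either 1 or 2 works as the factor c, since a + b and a + 2b cannot both vanish.
  avoid-zero : ∀ a b → Invertible a → ¬ ¬ (∃[ c ] Invertible c × Invertible (a + c * b))
  avoid-zero a b a⁻¹ = zero-or-invertible (a + 1# * b) >>= λ where
      (inj₂ inv) → return (1# , (1# , *-identityˡ 1#) , inv)
      -- Here a + 2b = 2(a + b) - a = -a, which is invertible.
      (inj₁ a+b≈0) → return (1# + 1# , two⁻¹ , Invertible-resp (begin
        - 1# * a
          ≈⟨ +-identityˡ (- 1# * a) ⟨
        0# + - 1# * a
          ≈⟨ +-congʳ (trans (*-congˡ a+b≈0) (zeroʳ (1# + 1#))) ⟨
        (1# + 1#) * (a + 1# * b) + - 1# * a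
          ≈⟨ solve 3 (λ a b e → (e :+ e) :* (a :+ e :* b) :+ (:- e) :* a
                             := e :* a :+ (e :+ e) :* e :* b :+ (e :* a :- e :* a))
               refl a b 1# ⟩
        1# * a + (1# + 1#) * 1# * b + (1# * a - 1# * a)
          ≈⟨ +-cong (+-cong (*-identityˡ a) (*-congʳ (*-identityʳ (1# + 1#)))) (-‿inverseʳ (1# * a)) ⟩
        a + (1# + 1#) * b + 0#
          ≈⟨ +-identityʳ _ ⟩
        a + (1# + 1#) * b ∎)
        (Invertible-* (- 1# , trans (solve 1 (λ e → :- e :* :- e := e :* e) refl 1#) (*-identityˡ 1#)) a⁻¹))
    where
    open K-Solver
    two⁻¹ : Invertible (1# + 1#)
    two⁻¹ = Invertible-resp (trans (+-homo ℚ.1ℚ ℚ.1ℚ) (+-cong 1-homo 1-homo))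
              (ι-invertible (ℚ.1ℚ ℚ.+ ℚ.1ℚ) λ ())

  -- Lowering the multiplicity of κ while keeping a spider

  module _ {n} (T : Tree n) (F : Fork T) (Leg? : ∀ i p → Dec (Leg T F i p)) where

    open Fork F
    open Graph (graph T) using (edge?; irreflexive) renaming (symmetric to ~-sym)

    -- Otherwise z would be proportional to X around p, and row p would give μ = κ.
    disagreeing-neighbour : ∀ {A κ μ} → Fits T A → Invertible (μ - κ) → ∀ {X z p} →
      A p ∙ X ≈ μ * X p → Eigenspace A κ z → Invertible (X p) → Invertible (z p) →
      ¬ ¬ (∃[ q ] Edge (graph T) p q × Invertible (X p * z q + - X q * z p))
    disagreeing-neighbour {A} {κ} {μ} fits μ-κ {X} {z} {p} X-eigen z-eigen Xₚ⁻¹ zₚ⁻¹ = do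
      decided ← ¬¬-∀ decide
      case ∀⊎∃ decided of λ where
        (inj₂ found) → return found
        (inj₁ agree) → contradiction
          (begin
            (μ - κ) * (X p * z p)
              ≈⟨ solve 4 (λ m k x z → (m :- k) :* (x :* z) := :- (x :* (k :* z) :+ (:- z) :* (m :* x)))
                   refl μ κ (X p) (z p) ⟩
            - (X p * (κ * z p) + - z p * (μ * X p))
              ≈⟨ -‿cong (+-cong (*-congˡ (z-eigen p)) (*-congˡ X-eigen)) ⟨
            - (X p * A p ∙ z + - z p * A p ∙ X)
              ≈⟨ -‿cong (trans
                   (+-cong (*-distribˡ-sum (X p) (λ q → A p q * z q))
                           (*-distribˡ-sum (- z p) (λ q → A p q * X q)))
                   (sym (∑-distrib-+ (λ q → X p * (A p q * z q)) (λ q → - z p * (A p q * X q))))) ⟩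
            - sum (λ q → X p * (A p q * z q) + - z p * (A p q * X q))
              ≈⟨ -‿cong (sum-cong-≋ λ q →
                   solve 5 (λ xp zp a xq zq → xp :* (a :* zq) :+ (:- zp) :* (a :* xq)
                                           := a :* (xp :* zq :+ (:- xq) :* zp))
                     refl (X p) (z p) (A p q) (X q) (z q)) ⟩
            - sum (λ q → A p q * (X p * z q + - X q * z p))
              ≈⟨ trans (-‿cong (sum-zero agree)) -0#≈0# ⟩
            0# ∎)
          (Invertible⇒≉0 (Invertible-* μ-κ (Invertible-* Xₚ⁻¹ zₚ⁻¹)))
      where
      open K-Solver
      open Fits fits
      decide : ∀ q → ¬ ¬ (A p q * (X p * z q + - X q * z p) ≈ 0# ⊎
                          Edge (graph T) p q × Invertible (X p * z q + - X q * z p))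
      decide q with p Fin.≟ q | edge? p q
      ... | yes ≡.refl | _       = return (inj₁ (trans (*-congˡ
              (solve 2 (λ x z → x :* z :+ (:- x) :* z := z :- z) refl (X p) (z p) ⟨ trans ⟩ -‿inverseʳ (z p)))
              (zeroʳ _)))
      ... | no p≢q     | no p≁q  = return (inj₁ (trans (*-congʳ (non-edge p≢q p≁q)) (zeroˡ _)))
      ... | no _       | yes p~q = zero-or-invertible (X p * z q + - X q * z p) >>= λ where
        (inj₁ eq)  → return (inj₁ (trans (*-congˡ eq) (zeroʳ _)))
        (inj₂ inv) → return (inj₂ (p~q , inv))

    -- A perturbation within S(T) that keeps the spider but not the κ-eigenvector z.
    Direction : ∀ {A μ} → Spider T F A μ → Vec n → Set
    Direction {A} spider z = ∃[ w ] ∃[ c ] Invertible c × Invertible (w ∙ z) ×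
      (∀ i → w ∙ Spider.x spider i ≈ 0#) × Fits T (perturb A c w)

    direction : ∀ {A κ μ} → Fits T A → Invertible (μ - κ) → (S : Spider T F A μ) → ∀ {z} →
                Eigenspace A κ z → Nonzero z → ¬ ¬ Direction S z
    direction {A} {κ} {μ} fits μ-κ S {z} z-eigen (p , zₚ⁻¹) = do
        values ← ¬¬-∀ λ i → zero-or-invertible (x i p)
        case ∀⊎∃ values of λ where
          -- The perturbation along e_p changes a diagonal entry only, so it stays in 𝒮(T).
          (inj₁ xₚ≈0)       → return (at-vertex xₚ≈0)
          (inj₂ (i , Xₚ⁻¹)) → do
            let p∈ = in-leg i Xₚ⁻¹
            q , p~q , wz⁻¹ ← disagreeing-neighbour fits μ-κ
              (eigen i (Leg-avoids T F p∈)) z-eigen Xₚ⁻¹ zₚ⁻¹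
            -- Off the diagonal, only the entry of the edge pq and its mirror image change; c is
            -- chosen to keep them nonzero.
            c , c⁻¹ , Aₚq⁻¹ ← avoid-zero (A p q) (along i q p * along i q q) (edge p~q)
            return (at-edge i p∈ p~q wz⁻¹ c c⁻¹ Aₚq⁻¹)
      where
      open Fits fits
      open Spider S
      open K-Solver

      in-leg : ∀ i → Invertible (x i p) → Leg T F i p
      in-leg i Xₚ⁻¹ with Leg? i p
      ... | yes p∈ = p∈
      ... | no p∉  = contradiction (support p∉) (Invertible⇒≉0 Xₚ⁻¹)

      at-vertex : (∀ i → x i p ≈ 0#) → Direction S z
      at-vertex xₚ≈0 = δ p , 1# , (1# , *-identityˡ 1#)
        , Invertible-resp (sym (δ-∙ p z)) zₚ⁻¹
        , (λ i → trans (δ-∙ p (x i)) (xₚ≈0 i))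
        , perturb-fits fits (λ a≢b _ → supported a≢b)
            (λ {a} {b} a~b → Invertible-resp
              (sym (trans (+-congˡ (trans (*-assoc 1# (δ p a) (δ p b))
                     (trans (*-congˡ (supported λ a≡b → irreflexive a≡b a~b)) (zeroʳ 1#))))
                     (+-identityʳ (A a b))))
              (edge a~b))
        where
        supported : ∀ {a b} → a ≢ b → δ p a * δ p b ≈ 0#
        supported {a} {b} a≢b with a Fin.≟ p
        ... | yes ≡.refl = trans (*-congˡ (reflexive (δ-off-diagonal (a≢b ∘ ≡.sym)))) (zeroʳ _)
        ... | no a≢p     = trans (*-congʳ (reflexive (δ-off-diagonal a≢p))) (zeroˡ _)

      -- Pairing with this vector gives the 2 × 2 minor of `x i` and the argument at p and q, which
      -- is zero on `x i` itself.
      along : Fin 3 → Fin n → Vec n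
      along i q j = x i p * δ q j + - x i q * δ p j

      along-∙ : ∀ i q y → along i q ∙ y ≈ x i p * y q + - x i q * y p
      along-∙ i q y = begin
        along i q ∙ y
          ≈⟨ ∙-distribʳ-+* (λ j → x i p * δ q j) (δ p) y (- x i q) ⟩
        (λ j → x i p * δ q j) ∙ y + - x i q * δ p ∙ y
          ≈⟨ +-cong (sum-cong-≋ λ j → *-assoc (x i p) (δ q j) (y j)) (*-congˡ (δ-∙ p y)) ⟩
        sum (λ j → x i p * (δ q j * y j)) + - x i q * y p
          ≈⟨ +-congʳ (*-distribˡ-sum (x i p) (λ j → δ q j * y j)) ⟨
        x i p * δ q ∙ y + - x i q * y p
          ≈⟨ +-congʳ (*-congˡ (δ-∙ q y)) ⟩
        x i p * y q + - x i q * y p ∎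

      along-support : ∀ i q {j} → j ≢ p → j ≢ q → along i q j ≈ 0#
      along-support i q {j} j≢p j≢q = trans
        (+-cong (trans (*-congˡ (reflexive (δ-off-diagonal j≢q))) (zeroʳ _))
                (trans (*-congˡ (reflexive (δ-off-diagonal j≢p))) (zeroʳ _)))
        (+-identityˡ 0#)

      at-edge : ∀ i → Leg T F i p → ∀ {q} → Edge (graph T) p q →
        Invertible (x i p * z q + - x i q * z p) → ∀ c → Invertible c →
        Invertible (A p q + c * (along i q p * along i q q)) → Direction S z
      at-edge i p∈ {q} p~q wz⁻¹ c c⁻¹ Aₚq⁻¹ = w , c , c⁻¹
        , Invertible-resp (sym (along-∙ i q z)) wz⁻¹
        , (λ j → trans (along-∙ i q (x j)) (orthogonal j))
        , perturb-fits fits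
            (λ {a} {b} a≢b a≁b → [ (λ { (inj₁ (≡.refl , ≡.refl)) → contradiction p~q a≁b
                                      ; (inj₂ (≡.refl , ≡.refl)) → contradiction (~-sym p~q) a≁b })
                                 , id ]′ (supported a≢b))
            (λ {a} {b} a~b → [ (λ { (inj₁ (≡.refl , ≡.refl)) → pq
                                  ; (inj₂ (≡.refl , ≡.refl)) → Invertible-resp
                                      (+-cong (symmetric p q)
                                        (solve 3 (λ c a b → c :* a :* b := c :* b :* a) refl c (w p) (w q))) pq })
                             , (λ eq → Invertible-resp
                                 (sym (trans (+-congˡ (trans (*-assoc c (w a) (w b)) (trans (*-congˡ eq) (zeroʳ c))))
                                   (+-identityʳ (A a b)))) (edge a~b)) ]′
                             (supported λ a≡b → irreflexive a≡b a~b))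
        where
        w = along i q
        pq : Invertible (perturb A c w p q)
        pq = Invertible-resp (+-congˡ (sym (*-assoc c (w p) (w q)))) Aₚq⁻¹
        supported : ∀ {a b} → a ≢ b →
          ((a ≡ p × b ≡ q) ⊎ (a ≡ q × b ≡ p)) ⊎ w a * w b ≈ 0#
        supported {a} {b} a≢b with a Fin.≟ p | a Fin.≟ q | b Fin.≟ p | b Fin.≟ q
        ... | yes a≡p | _       | _       | yes b≡q = inj₁ (inj₁ (a≡p , b≡q))
        ... | _       | yes a≡q | yes b≡p | _       = inj₁ (inj₂ (a≡q , b≡p))
        ... | no a≢p  | no a≢q  | _       | _       =
          inj₂ (trans (*-congʳ (along-support i q a≢p a≢q)) (zeroˡ _))
        ... | _       | _       | no b≢p  | no b≢q  =
          inj₂ (trans (*-congˡ (along-support i q b≢p b≢q)) (zeroʳ _))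
        ... | yes a≡p | _       | yes b≡p | _       =
          contradiction (≡.trans a≡p (≡.sym b≡p)) a≢b
        ... | _       | yes a≡q | _       | yes b≡q =
          contradiction (≡.trans a≡q (≡.sym b≡q)) a≢b
        -- The neighbour q of p is v or lies on the same branch as p, and the other two vectors
        -- vanish at both kinds of vertex.
        elsewhere : ∀ {j} → j ≢ i → x j q ≈ 0#
        elsewhere {j} j≢i with Leg-closed T F p∈ p~q
        ... | inj₁ ≡.refl = support λ v∈ → Leg-avoids T F v∈ ≡.refl
        ... | inj₂ q∈     = support λ q∈′ → j≢i (Leg-disjoint T F q∈′ q∈)
        orthogonal : ∀ j → x i p * x j q + - x i q * x j p ≈ 0#
        orthogonal j with j Fin.≟ i
        ... | yes ≡.refl = trans
          (solve 2 (λ a b → a :* b :+ (:- b) :* a := b :- b) refl (x i p) (x i q)) (-‿inverseʳ (x i q))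
        ... | no j≢i = trans
          (+-cong (trans (*-congˡ (elsewhere j≢i)) (zeroʳ _))
                  (trans (*-congˡ (support λ p∈′ → j≢i (Leg-disjoint T F p∈′ p∈))) (zeroʳ _)))
          (+-identityˡ 0#)

    -- The direction is taken for the first basis vector. Being orthogonal to w, the vectors of the
    -- spider serve unchanged for the new matrix.
    lower-multiplicity : ∀ {A κ μ r} → Fits T A → Invertible (μ - κ) → Spider T F A μ →
      HasDimension (Eigenspace A κ) (suc r) →
      ¬ ¬ (∃[ A′ ] Fits T A′ × Spider T F A′ μ × HasDimension (Eigenspace A′ κ) r)
    lower-multiplicity {A} {κ} {μ} fits μ-κ S (b , basis) = do
      nonzero ← basis-nonzero basis zero
      w , c , c⁻¹ , wb⁻¹ , wx≈0 , fits′ ← direction fits μ-κ S (members basis zero) nonzero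
      return (perturb A c w , fits′
        , record
          { x       = x
          ; support = support
          ; root    = root
          ; eigen   = λ i p≢v → trans (perturb-fixes A c w (x i) (wx≈0 i) _) (eigen i p≢v)
          }
        , perturb-dimension A κ c w (Fits.symmetric fits) c⁻¹ basis wb⁻¹)
      where open Spider S

    lower-multiplicity* : ∀ {κ μ} r d {A} → Fits T A → Invertible (μ - κ) → Spider T F A μ →
      HasDimension (Eigenspace A κ) (d ℕ.+ r) →
      ¬ ¬ (∃[ A′ ] Fits T A′ × Spider T F A′ μ × HasDimension (Eigenspace A′ κ) r)
    lower-multiplicity* r zero    {A} fits μ-κ S dim = return (A , fits , S , dim)
    lower-multiplicity* r (suc d) fits μ-κ S dim = do
      _ , fits′ , S′ , dim′ ← lower-multiplicity fits μ-κ S dim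
      lower-multiplicity* r d fits′ μ-κ S′ dim′

    -- True eigenvectors from a spider

    module _ {A μ} (S : Spider T F A μ) where

      open Spider S

      -- The amounts by which the three vectors fail row v; a combination is a true eigenvector once
      -- its total defect is zero.
      spider-defect : Vec 3
      spider-defect i = shifted-row A μ v ∙ x i

      spider-eigenvector : ∀ a → spider-defect ∙ a ≈ 0# → Eigenspace A μ (combination a x)
      spider-eigenvector a eq p = shifted-row≈0⁻¹ A μ p _
        (trans (∙-combination (shifted-row A μ p) a x) (row (p Fin.≟ v)))
        where
        row : Dec (p ≡ v) → sum (λ i → a i * shifted-row A μ p ∙ x i) ≈ 0#
        row (yes ≡.refl) = trans (∙-comm a spider-defect) eq
        row (no p≢v)     = sum-zero λ i →
          trans (*-congˡ (shifted-row≈0 A μ p (x i) (eigen i p≢v))) (zeroʳ (a i))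

      -- The other two vectors vanish at u i, so the coefficients can be read off at the roots and a
      -- nonzero choice gives a nonzero vector.
      combination-root : ∀ a i → combination a x (u i) ≈ a i * x i (u i)
      combination-root a i = sum-single i λ j j≢i → trans
        (*-congˡ (support λ uᵢ∈ → j≢i (Leg-disjoint T F uᵢ∈ (Leg-root T F i)))) (zeroʳ (a j))

      spider-nonzero : ∀ {a} → Nonzero a → Nonzero (combination a x)
      spider-nonzero {a} (i , aᵢ⁻¹) =
        u i , Invertible-resp (sym (combination-root a i)) (Invertible-* aᵢ⁻¹ (root i))

      spider-eigenvalue : ¬ ¬ (∃[ y ] Eigenspace A μ y × Nonzero y)
      spider-eigenvalue = do
        a , eq ∷ [] , nonzero ← underdetermined (spider-defect ∷ []) (s≤s (s≤s z≤n))
        return (combination a x , spider-eigenvector a eq , spider-nonzero nonzero)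

      -- A one-dimensional eigenspace would contain no nonzero vector that
      -- vanishes at a coordinate where its basis vector does not.
      spider-not-simple : ¬ HasDimension (Eigenspace A μ) 1
      spider-not-simple (b , basis) = contradiction id (do
        p , bₚ⁻¹ ← basis-nonzero basis zero
        a , eq ∷ aₚ≈0 ∷ [] , nonzero ←
          -- Two conditions on three coefficients: no defect at v, and value zero at p.
          underdetermined (spider-defect ∷ (λ i → x i p) ∷ []) (s≤s (s≤s (s≤s z≤n)))
        let y = combination a x
            c , y≈cb = spanning basis y (spider-eigenvector a eq)
            c₀≈0 : c zero ≈ 0#
            c₀≈0 = cancelˡ bₚ⁻¹ (begin
              b zero p * c zero          ≈⟨ *-comm (b zero p) (c zero) ⟩
              c zero * b zero p          ≈⟨ +-identityʳ _ ⟨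
              combination c b p          ≈⟨ y≈cb p ⟨
              y p                        ≈⟨ ∙-comm a (λ i → x i p) ⟩
              (λ i → x i p) ∙ a          ≈⟨ aₚ≈0 ⟩
              0#                         ∎)
            q , y_q⁻¹ = spider-nonzero {a} nonzero
        contradiction
          (trans (y≈cb q) (sum-zero {t = λ s → c s * b s q} λ { zero → trans (*-congʳ c₀≈0) (zeroˡ _) }))
          (Invertible⇒≉0 y_q⁻¹))

  -- Growing a spider constrains three coordinates of the κ-eigenvectors and so
  -- costs at most 3 dimensions.
  intermediate-multiplicity : ∀ {n} (T : Tree n) {A κ M r} → Fits T A →
    HasDimension (Eigenspace A κ) M → 3 ℕ.+ r ≤ M →
    ¬ ¬ (∃[ A′ ] ∃[ μ ] Fits T A′ × HasDimension (Eigenspace A′ κ) r × Invertible (μ - κ) ×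
         (∃[ y ] Eigenspace A′ μ y × Nonzero y) × ¬ HasDimension (Eigenspace A′ μ) 1)
  intermediate-multiplicity {n} T {A} {κ} {M} {r} fits dim 3+r≤M = do
    F ← multiplicity≥3⇒Fork T fits dim (ℕ.m+n≤o⇒m≤o 3 3+r≤M)
    let open Fork F
        roots = List.tabulate (δ ∘ u)
    Leg? ← ¬¬-∀ λ i → ¬¬-∀ λ p → ¬¬-excluded-middle
    A₁ , μ , fits₁ , μ-κ , S₁ , inherits ← grow-spider T F Leg? κ fits
    s , M≤ , dim-cut ← cut-all (HasDimension-resp (Eigenspace⇒Kernel A κ) (Kernel⇒Eigenspace A κ) dim)
                         roots
    -- Lowering needs a basis of the new κ-eigenspace to start from. Its dimension t may exceed s,
    -- so the number of steps is t - r.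
    t , _ , dim₁ ← Kernel-dimension (shifted-rows A₁ κ)
    let dim₁′ = HasDimension-resp (Kernel⇒Eigenspace A₁ κ) (Eigenspace⇒Kernel A₁ κ) dim₁
        s≤t : s ≤ t
        s≤t = dimension-mono dim-cut dim₁′ λ z z∈ → inherits z
          (Kernel⇒Eigenspace A κ z (All.++⁻ʳ roots z∈))
          (λ i → trans (sym (δ-∙ (u i) z)) (All.tabulate⁻ {f = δ ∘ u} (All.++⁻ˡ roots z∈) i))
        r≤t : r ≤ t
        r≤t = ℕ.≤-trans (ℕ.+-cancelˡ-≤ 3 r s (ℕ.≤-trans 3+r≤M M≤)) s≤t
    A₂ , fits₂ , S₂ , dim₂ ← lower-multiplicity* T F Leg? r (t ℕ.∸ r) fits₁ μ-κ S₁
      (≡.subst (HasDimension (Eigenspace A₁ κ)) (≡.sym (ℕ.m∸n+n≡m r≤t)) dim₁′)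
    eigenvector ← spider-eigenvalue T F Leg? S₂
    return (A₂ , μ , fits₂ , dim₂ , μ-κ , eigenvector , spider-not-simple T F Leg? S₂)

  -- Passage between 𝒮(T) and `Fits`

  Fits-intro : ∀ {n} {T : Tree n} {A : Matrix n} → (∀ i j → A i j ≈ A j i) →
    (∀ i j → i ≢ j → (¬ (A i j ≈ 0#)) ⇔ Edge (graph T) i j) → ¬ ¬ Fits T A
  Fits-intro {T = T} {A} symmetric support = do
    -- The zero pattern speaks only of entries not being zero; testing the finitely many entries
    -- yields the inverses and equations.
    entries ← ¬¬-∀ λ i → ¬¬-∀ λ j → entry i j
    return record
      { symmetric = symmetric
      ; edge      = λ {i} {j} → proj₁ (entries i j)
      ; non-edge  = λ {i} {j} → proj₂ (entries i j)
      }
    where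
    open Graph (graph T) using (irreflexive)
    entry : ∀ i j → ¬ ¬ ((Edge (graph T) i j → Invertible (A i j)) ×
                         (i ≢ j → ¬ Edge (graph T) i j → A i j ≈ 0#))
    entry i j = zero-or-invertible (A i j) >>= λ where
        (inj₁ A≈0) → return
          ((λ e → contradiction A≈0
              (Equivalence.from (support i j λ i≡j → irreflexive i≡j e) e)) , λ _ _ → A≈0)
        (inj₂ A⁻¹) → return
          ((λ _ → A⁻¹) , λ i≢j ¬e →
              contradiction (Equivalence.to (support i j i≢j) (Invertible⇒≉0 A⁻¹)) ¬e)

  Fits⇒support : ∀ {n} {T : Tree n} {A : Matrix n} → Fits T A →
    ∀ i j → i ≢ j → (¬ (A i j ≈ 0#)) ⇔ Edge (graph T) i j
  Fits⇒support {T = T} fits i j i≢j = mk⇔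
    (λ A≉0 → case edge? i j of λ where
      (yes e) → e
      (no ¬e) → contradiction (non-edge i≢j ¬e) A≉0)
    (λ e → Invertible⇒≉0 (edge e))
    where
    open Graph (graph T) using (edge?)
    open Fits fits

  not-all-simple : ∀ {n} (T : Tree n) {A κ M r} → Fits T A →
    HasDimension (Eigenspace A κ) M → 3 ℕ.+ r ≤ M →
    ¬ (∀ A′ μ → Fits T A′ → HasDimension (Eigenspace A′ κ) r →
       (∃[ y ] Eigenspace A′ μ y × ¬ IsZero y) → ¬ (μ ≈ κ) →
       HasDimension (Eigenspace A′ μ) 1)
  not-all-simple T fits dim 3+r≤M simple = contradiction id (do
    A′ , μ , fits′ , dim′ , μ-κ , (y , y-eigen , p , yₚ⁻¹) , not-simple ←
      intermediate-multiplicity T fits dim 3+r≤M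
    contradiction
      (simple A′ μ fits′ dim′
        (y , y-eigen , λ y≈0 → Invertible⇒≉0 yₚ⁻¹ (y≈0 p))
        (λ μ≈κ → Invertible⇒≉0 μ-κ (x≈y⇒x-y≈0 μ≈κ)))
      not-simple)

-- Real arithmetic

open import Defs

Eventually : (ℕ → Set) → Set
Eventually P = ∃[ N ] ∀ n → N ℕ.≤ n → P n

Eventually-zip : ∀ {P Q R : ℕ → Set} → (∀ n → P n → Q n → R n) →
                 Eventually P → Eventually Q → Eventually R
Eventually-zip f (M , p) (N , q) = M ℕ.⊔ N , λ n le →
  f n (p n (ℕ.m⊔n≤o⇒m≤o M N le)) (q n (ℕ.m⊔n≤o⇒n≤o M N le))

½-pos : ∀ ε → .{{Positive ε}} → Positive (½ ℚ.* ε)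
½-pos ε = ℚ.pos*pos⇒pos ½ ε

½+½ : ∀ ε → ½ ℚ.* ε ℚ.+ ½ ℚ.* ε ≡ ε
½+½ ε = ≡.trans (≡.sym (ℚ.*-distribʳ-+ ε ½ ½)) (ℚ.*-identityˡ ε)

distance-sym : ∀ p q → ∣ p ℚ.- q ∣ ≡ ∣ q ℚ.- p ∣
distance-sym p q = ≡.trans (≡.sym (ℚ.∣-p∣≡∣p∣ (p ℚ.- q)))
  (≡.cong ∣_∣ (solve 2 (λ a b → :- (a :- b) := b :- a) ≡.refl p q))
  where open ℚ-Solver

distance-trans : ∀ p q r → ∣ p ℚ.- r ∣ ℚ.≤ ∣ p ℚ.- q ∣ ℚ.+ ∣ q ℚ.- r ∣
distance-trans p q r = ℚ.≤-trans
  (ℚ.≤-reflexive (≡.cong ∣_∣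
    (solve 3 (λ a b c → a :- c := (a :- b) :+ (b :- c)) ≡.refl p q r)))
  (ℚ.∣p+q∣≤∣p∣+∣q∣ (p ℚ.- q) (q ℚ.- r))
  where open ℚ-Solver

≈-pointwise : ∀ {x y} → (∀ n → seq x n ≡ seq y n) → x ≈ y
≈-pointwise {x} {y} eq = mk≈ λ ε → 0 , λ n _ → begin
  ∣ seq x n ℚ.- seq y n ∣  ≡⟨ ≡.cong (λ t → ∣ t ℚ.- seq y n ∣) (eq n) ⟩
  ∣ seq y n ℚ.- seq y n ∣  ≡⟨ ≡.cong ∣_∣ (ℚ.+-inverseʳ (seq y n)) ⟩
  0ℚ                       ≤⟨ ℚ.nonNegative⁻¹ ε {{ℚ.pos⇒nonNeg ε}} ⟩
  ε                        ∎
  where open ℚ.≤-Reasoning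

≈-refl : ∀ {x} → x ≈ x
≈-refl = ≈-pointwise λ _ → ≡.refl

≈-sym : ∀ {x y} → x ≈ y → y ≈ x
≈-sym {x} {y} (mk≈ p) = mk≈ λ ε → let N , h = p ε in
  N , λ n le → ≡.subst (ℚ._≤ ε) (distance-sym (seq x n) (seq y n)) (h n le)

≈-trans : ∀ {x y z} → x ≈ y → y ≈ z → x ≈ z
≈-trans {x} {y} {z} (mk≈ p) (mk≈ q) = mk≈ λ ε →
  Eventually-zip
    (λ n a b → ℚ.≤-trans (distance-trans (seq x n) (seq y n) (seq z n))
                 (ℚ.≤-trans (ℚ.+-mono-≤ a b) (ℚ.≤-reflexive (½+½ ε))))
    (p (½ ℚ.* ε) {{½-pos ε}}) (q (½ ℚ.* ε) {{½-pos ε}})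

+-cong : ∀ {x x′ y y′} → x ≈ x′ → y ≈ y′ → x + y ≈ x′ + y′
+-cong {x} {x′} {y} {y′} (mk≈ p) (mk≈ q) = mk≈ λ ε →
  Eventually-zip
    (λ n a b → begin
      ∣ (seq x n ℚ.+ seq y n) ℚ.- (seq x′ n ℚ.+ seq y′ n) ∣
        ≡⟨ ≡.cong ∣_∣ (rearrange (seq x n) (seq y n) (seq x′ n) (seq y′ n)) ⟩
      ∣ (seq x n ℚ.- seq x′ n) ℚ.+ (seq y n ℚ.- seq y′ n) ∣
        ≤⟨ ℚ.∣p+q∣≤∣p∣+∣q∣ (seq x n ℚ.- seq x′ n) (seq y n ℚ.- seq y′ n) ⟩
      ∣ seq x n ℚ.- seq x′ n ∣ ℚ.+ ∣ seq y n ℚ.- seq y′ n ∣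
        ≤⟨ ℚ.+-mono-≤ a b ⟩
      ½ ℚ.* ε ℚ.+ ½ ℚ.* ε
        ≡⟨ ½+½ ε ⟩
      ε ∎)
    (p (½ ℚ.* ε) {{½-pos ε}}) (q (½ ℚ.* ε) {{½-pos ε}})
  where
  open ℚ.≤-Reasoning
  rearrange : ∀ a b c d → (a ℚ.+ b) ℚ.- (c ℚ.+ d) ≡ (a ℚ.- c) ℚ.+ (b ℚ.- d)
  rearrange = solve 4 (λ a b c d →
    (a :+ b) :- (c :+ d) := (a :- c) :+ (b :- d)) ≡.refl
    where open ℚ-Solver

1ℝ : ℝ
1ℝ = fromℚ 1ℚ

bounded : ∀ x → ∃[ B ] Positive B × Eventually λ n → ∣ seq x n ∣ ℚ.≤ B
bounded x = 1ℚ ℚ.+ ∣ seq x N ∣ , B-pos , N , λ n le → begin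
  ∣ seq x n ∣                                ≡⟨ ≡.cong ∣_∣ (≡.sym (minus-0 (seq x n))) ⟩
  ∣ seq x n ℚ.- 0ℚ ∣                         ≤⟨ distance-trans (seq x n) (seq x N) 0ℚ ⟩
  ∣ seq x n ℚ.- seq x N ∣ ℚ.+ ∣ seq x N ℚ.- 0ℚ ∣
    ≤⟨ ℚ.+-mono-≤ (h n N le ℕ.≤-refl) (ℚ.≤-reflexive (≡.cong ∣_∣ (minus-0 (seq x N)))) ⟩
  1ℚ ℚ.+ ∣ seq x N ∣                         ∎
  where
  open ℚ.≤-Reasoning
  N = proj₁ (cauchy x 1ℚ)
  h = proj₂ (cauchy x 1ℚ)
  B-pos : Positive (1ℚ ℚ.+ ∣ seq x N ∣)
  B-pos = ℚ.positive (ℚ.+-mono-<-≤ (ℚ.positive⁻¹ 1ℚ) (ℚ.0≤∣p∣ (seq x N)))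
  minus-0 : ∀ p → p ℚ.- 0ℚ ≡ p
  minus-0 = ℚ.+-identityʳ

-- With B an eventual bound for y, closeness of x and x′ within ε/B suffices.
*-congʳ : ∀ {x x′} y → x ≈ x′ → x * y ≈ x′ * y
*-congʳ {x} {x′} y (mk≈ p) = from-bound (bounded y)
  where
  open ℚ.≤-Reasoning
  rearrange : ∀ a b c → a ℚ.* b ℚ.* c ≡ b ℚ.* (a ℚ.* c)
  rearrange = solve 3 (λ a b c → a :* b :* c := b :* (a :* c)) ≡.refl
    where open ℚ-Solver
  factor : ∀ a b c → a ℚ.* c ℚ.- b ℚ.* c ≡ (a ℚ.- b) ℚ.* c
  factor = solve 3 (λ a b c → a :* c :- b :* c := (a :- b) :* c) ≡.refl
    where open ℚ-Solver
  small : ∀ {B δ} → Positive δ → ∀ a b c → ∣ a ℚ.- b ∣ ℚ.≤ δ → ∣ c ∣ ℚ.≤ B →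
          ∣ a ℚ.* c ℚ.- b ℚ.* c ∣ ℚ.≤ δ ℚ.* B
  small {B} {δ} δ-pos a b c a-b≤δ c≤B = begin
    ∣ a ℚ.* c ℚ.- b ℚ.* c ∣    ≡⟨ ≡.cong ∣_∣ (factor a b c) ⟩
    ∣ (a ℚ.- b) ℚ.* c ∣        ≡⟨ ℚ.∣p*q∣≡∣p∣*∣q∣ (a ℚ.- b) c ⟩
    ∣ a ℚ.- b ∣ ℚ.* ∣ c ∣      ≤⟨ ℚ.*-monoʳ-≤-nonNeg ∣ c ∣ {{ℚ.∣-∣-nonNeg c}} a-b≤δ ⟩
    δ ℚ.* ∣ c ∣                ≤⟨ ℚ.*-monoˡ-≤-nonNeg δ {{ℚ.pos⇒nonNeg δ {{δ-pos}}}} c≤B ⟩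
    δ ℚ.* B                    ∎
  divide : ∀ B → Positive B → ∀ ε → .{{Positive ε}} → ∃[ δ ] Positive δ × δ ℚ.* B ≡ ε
  divide B B-pos ε =
    ℚ.1/ B ℚ.* ε
    , ℚ.pos*pos⇒pos (ℚ.1/ B) {{ℚ.1/pos⇒pos B {{B-pos}}}} ε
    , ≡.trans (rearrange (ℚ.1/ B) ε B)
        (≡.trans (≡.cong (ε ℚ.*_) (ℚ.*-inverseˡ B)) (ℚ.*-identityʳ ε))
    where
    instance
      B-nonZero : ℚ.NonZero B
      B-nonZero = ℚ.pos⇒nonZero B {{B-pos}}
  from-bound : (∃[ B ] Positive B × Eventually λ n → ∣ seq y n ∣ ℚ.≤ B) → x * y ≈ x′ * y
  from-bound (B , B-pos , y≤B) = mk≈ λ ε → from-δ ε (divide B B-pos ε)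
    where
    from-δ : ∀ ε → .{{_ : Positive ε}} → (∃[ δ ] Positive δ × δ ℚ.* B ≡ ε) →
             Eventually λ n → ∣ seq x n ℚ.* seq y n ℚ.- seq x′ n ℚ.* seq y n ∣ ℚ.≤ ε
    from-δ ε (δ , δ-pos , ≡.refl) = Eventually-zip
      (λ n → small δ-pos (seq x n) (seq x′ n) (seq y n)) (p δ {{δ-pos}}) y≤B

*-comm : ∀ x y → x * y ≈ y * x
*-comm x y = ≈-pointwise λ n → ℚ.*-comm (seq x n) (seq y n)

*-cong : ∀ {x x′ y y′} → x ≈ x′ → y ≈ y′ → x * y ≈ x′ * y′
*-cong {x} {x′} {y} {y′} p q =
  ≈-trans {x * y} {x′ * y} {x′ * y′} (*-congʳ {x} {x′} y p)
    (≈-trans {x′ * y} {y * x′} {x′ * y′} (*-comm x′ y)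
      (≈-trans {y * x′} {y′ * x′} {x′ * y′} (*-congʳ {y} {y′} x′ q) (*-comm y′ x′)))

≈-isEquivalence : IsEquivalence _≈_
≈-isEquivalence = record
  { refl  = λ {x} → ≈-refl {x}
  ; sym   = λ {x} {y} → ≈-sym {x} {y}
  ; trans = λ {x} {y} {z} → ≈-trans {x} {y} {z}
  }

-1*p+p≡0 : ∀ p → ℚ.- 1ℚ ℚ.* p ℚ.+ p ≡ 0ℚ
-1*p+p≡0 = solve 1 (λ p → con (ℚ.- 1ℚ) :* p :+ p := con 0ℚ) ≡.refl
  where open ℚ-Solver

infix 8 -_

-- Opaque, so that conversion checking does not descend into Cauchy proofs.
opaque
  -_ : ℝ → ℝ
  - x = fromℚ (ℚ.- 1ℚ) * x

  -‿cong : ∀ x y → x ≈ y → - x ≈ - y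
  -‿cong x y p = *-cong {fromℚ (ℚ.- 1ℚ)} {fromℚ (ℚ.- 1ℚ)} {x} {y} ≈-refl p

  -‿inverseˡ : ∀ x → - x + x ≈ 0ℝ
  -‿inverseˡ x = ≈-pointwise λ n → -1*p+p≡0 (seq x n)

  -‿inverseʳ : ∀ x → x + - x ≈ 0ℝ
  -‿inverseʳ x = ≈-pointwise λ n → ≡.trans (ℚ.+-comm (seq x n) _) (-1*p+p≡0 (seq x n))

  -‿homo : ∀ p → fromℚ (ℚ.- p) ≈ - fromℚ p
  -‿homo p = ≈-pointwise λ _ →
    ≡.trans (≡.cong ℚ.-_ (≡.sym (ℚ.*-identityˡ p))) (ℚ.neg-distribˡ-* 1ℚ p)

+-assoc : ∀ x y z → (x + y) + z ≈ x + (y + z)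
+-assoc x y z = ≈-pointwise λ n → ℚ.+-assoc (seq x n) (seq y n) (seq z n)

+-comm : ∀ x y → x + y ≈ y + x
+-comm x y = ≈-pointwise λ n → ℚ.+-comm (seq x n) (seq y n)

+-identityˡ : ∀ x → 0ℝ + x ≈ x
+-identityˡ x = ≈-pointwise λ n → ℚ.+-identityˡ (seq x n)

+-identityʳ : ∀ x → x + 0ℝ ≈ x
+-identityʳ x = ≈-pointwise λ n → ℚ.+-identityʳ (seq x n)

*-assoc : ∀ x y z → (x * y) * z ≈ x * (y * z)
*-assoc x y z = ≈-pointwise λ n → ℚ.*-assoc (seq x n) (seq y n) (seq z n)

*-identityˡ : ∀ x → 1ℝ * x ≈ x
*-identityˡ x = ≈-pointwise λ n → ℚ.*-identityˡ (seq x n)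

*-identityʳ : ∀ x → x * 1ℝ ≈ x
*-identityʳ x = ≈-pointwise λ n → ℚ.*-identityʳ (seq x n)

*-distribˡ-+ : ∀ x y z → x * (y + z) ≈ x * y + x * z
*-distribˡ-+ x y z = ≈-pointwise λ n → ℚ.*-distribˡ-+ (seq x n) (seq y n) (seq z n)

*-distribʳ-+ : ∀ x y z → (y + z) * x ≈ y * x + z * x
*-distribʳ-+ x y z = ≈-pointwise λ n → ℚ.*-distribʳ-+ (seq x n) (seq y n) (seq z n)

+-0-isGroup : IsGroup _≈_ _+_ 0ℝ -_
+-0-isGroup = record
  { isMonoid = record
    { isSemigroup = record
      { isMagma = record
        { isEquivalence = ≈-isEquivalence
        ; ∙-cong = λ {x} {x′} {y} {y′} → +-cong {x} {x′} {y} {y′}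
        }
      ; assoc = +-assoc
      }
    ; identity = +-identityˡ , +-identityʳ
    }
  ; inverse = -‿inverseˡ , -‿inverseʳ
  ; ⁻¹-cong = -‿cong _ _
  }

+-*-isRing : IsRing _≈_ _+_ _*_ -_ 0ℝ 1ℝ
+-*-isRing = record
  { +-isAbelianGroup = record { isGroup = +-0-isGroup ; comm = +-comm }
  ; *-cong = λ {x} {x′} {y} {y′} → *-cong {x} {x′} {y} {y′}
  ; *-assoc = *-assoc
  ; *-identity = *-identityˡ , *-identityʳ
  ; distrib = *-distribˡ-+ , *-distribʳ-+
  }

ℝ-commutativeRing : CommutativeRing 0ℓ 0ℓ
ℝ-commutativeRing = record
  { isCommutativeRing = record { isRing = +-*-isRing ; *-comm = *-comm } }

fromℚ-homomorphism : CommutativeRing.rawRing ℚ.+-*-commutativeRing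
                     -Raw-AlmostCommutative⟶ fromCommutativeRing ℝ-commutativeRing
fromℚ-homomorphism = record
  { ⟦_⟧    = fromℚ
  ; +-homo = λ _ _ → ≈-pointwise λ _ → ≡.refl
  ; *-homo = λ _ _ → ≈-pointwise λ _ → ≡.refl
  ; -‿homo = -‿homo
  ; 0-homo = ≈-refl
  ; 1-homo = ≈-refl
  }

-- Inverses of real numbers

infix 4 _≈?0

<⇒≱ℚ : ∀ {p q} → p ℚ.< q → ¬ (q ℚ.≤ p)
<⇒≱ℚ p<q q≤p = ℚ.<-irrefl ≡.refl (ℚ.<-≤-trans p<q q≤p)

Invertible : ℝ → Set
Invertible x = ∃[ y ] x * y ≈ 1ℝ

-- The value at 0 is a default: finitely many terms of an invertible real may be zero.
recip : ℚ → ℚ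
recip p with p ℚ.≟ 0ℚ
... | yes _ = 0ℚ
... | no p≢0 = ℚ.1/_ p {{ℚ.≢-nonZero p≢0}}

*-recip : ∀ p → p ≢ 0ℚ → p ℚ.* recip p ≡ 1ℚ
*-recip p p≢0 with p ℚ.≟ 0ℚ
... | yes p≡0 = contradiction p≡0 p≢0
... | no  p≢0 = ℚ.*-inverseʳ p {{ℚ.≢-nonZero p≢0}}

-- The terms are inverted one by one. Since |1/a - 1/b| = |b - a|/|ab| is at most |b - a|/δ², the
-- modulus of x at εδ² serves for ε.
bounded-away⇒invertible : ∀ x δ → Positive δ → Eventually (λ n → δ ℚ.≤ ∣ seq x n ∣) →
                          Invertible x
bounded-away⇒invertible x δ δ-pos (N , δ≤) =
  y , mk≈ λ ε → N , λ n le → ≡.subst (λ t → ∣ t ℚ.- 1ℚ ∣ ℚ.≤ ε)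
    (≡.sym (inverse n le)) (ℚ.nonNegative⁻¹ ε {{ℚ.pos⇒nonNeg ε}})
  where
  open ℚ.≤-Reasoning
  instance
    δ-positive : Positive δ
    δ-positive = δ-pos
    δδ-positive : Positive (δ ℚ.* δ)
    δδ-positive = ℚ.pos*pos⇒pos δ δ
  inverse : ∀ n → N ≤ n → seq x n ℚ.* recip (seq x n) ≡ 1ℚ
  inverse n le = *-recip (seq x n) λ x≡0 → <⇒≱ℚ (ℚ.positive⁻¹ δ)
    (≡.subst (λ t → δ ℚ.≤ ∣ t ∣) x≡0 (δ≤ n le))
  rearrange : ∀ a b a′ b′ →
    (a′ ℚ.- b′) ℚ.* (a ℚ.* b) ≡ (a ℚ.* a′) ℚ.* b ℚ.- a ℚ.* (b ℚ.* b′)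
  rearrange = solve 4 (λ a b a′ b′ →
    (a′ :- b′) :* (a :* b) := (a :* a′) :* b :- a :* (b :* b′)) ≡.refl
    where open ℚ-Solver
  cross : ∀ a b a′ b′ → a ℚ.* a′ ≡ 1ℚ → b ℚ.* b′ ≡ 1ℚ →
          (a′ ℚ.- b′) ℚ.* (a ℚ.* b) ≡ b ℚ.- a
  cross a b a′ b′ p q = ≡.trans (rearrange a b a′ b′) (≡.cong₂ ℚ._-_
    (≡.trans (≡.cong (ℚ._* b) p) (ℚ.*-identityˡ b))
    (≡.trans (≡.cong (a ℚ.*_) q) (ℚ.*-identityʳ a)))
  y : ℝ
  seq y n = recip (seq x n)
  cauchy y ε = M ℕ.⊔ N , λ m n le-m le-n →
    let a = seq x m ; b = seq x n
        N≤m = ℕ.m⊔n≤o⇒n≤o M N le-m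
        N≤n = ℕ.m⊔n≤o⇒n≤o M N le-n
        d = recip a ℚ.- recip b
    in ℚ.*-cancelʳ-≤-pos (δ ℚ.* δ) (begin
      ∣ d ∣ ℚ.* (δ ℚ.* δ)
        ≤⟨ ℚ.*-monoˡ-≤-nonNeg ∣ d ∣ {{ℚ.∣-∣-nonNeg d}}
             (ℚ.≤-trans (ℚ.*-monoˡ-≤-nonNeg δ {{ℚ.pos⇒nonNeg δ}} (δ≤ n N≤n))
               (ℚ.*-monoʳ-≤-nonNeg ∣ b ∣ {{ℚ.∣-∣-nonNeg b}} (δ≤ m N≤m))) ⟩
      ∣ d ∣ ℚ.* (∣ a ∣ ℚ.* ∣ b ∣)
        ≡⟨ ≡.cong (∣ d ∣ ℚ.*_) (≡.sym (ℚ.∣p*q∣≡∣p∣*∣q∣ a b)) ⟩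
      ∣ d ∣ ℚ.* ∣ a ℚ.* b ∣
        ≡⟨ ≡.sym (ℚ.∣p*q∣≡∣p∣*∣q∣ d (a ℚ.* b)) ⟩
      ∣ d ℚ.* (a ℚ.* b) ∣
        ≡⟨ ≡.cong ∣_∣ (cross a b (recip a) (recip b) (inverse m N≤m) (inverse n N≤n)) ⟩
      ∣ b ℚ.- a ∣
        ≤⟨ close n m (ℕ.m⊔n≤o⇒m≤o M N le-n) (ℕ.m⊔n≤o⇒m≤o M N le-m) ⟩
      ε ℚ.* (δ ℚ.* δ) ∎)
    where
    η-pos = ℚ.pos*pos⇒pos ε (δ ℚ.* δ)
    M     = proj₁ (cauchy x (ε ℚ.* (δ ℚ.* δ)) {{η-pos}})
    close = proj₂ (cauchy x (ε ℚ.* (δ ℚ.* δ)) {{η-pos}})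

-- If a term past the modulus for ε/2 exceeds ε in absolute value, all terms past it are at least
-- ε/2, so x is invertible and `k` is refuted. Hence under `k` the sequence tends to 0.
_≈?0 : ∀ x → ¬ ¬ (x ≈ 0ℝ ⊎ Invertible x)
(x ≈?0) k = k (inj₁ (mk≈ λ ε → proj₁ (cauchy x (½ ℚ.* ε) {{½-pos ε}}) , small ε))
  where
  open ℚ.≤-Reasoning
  small : ∀ ε → .{{_ : Positive ε}} → ∀ n →
          proj₁ (cauchy x (½ ℚ.* ε) {{½-pos ε}}) ≤ n → ∣ seq x n ℚ.- 0ℚ ∣ ℚ.≤ ε
  small ε n N≤n with ∣ seq x n ℚ.- 0ℚ ∣ ℚ.≤? ε
  ... | yes p = p
  ... | no  p = contradiction (inj₂ (bounded-away⇒invertible x (½ ℚ.* ε) (½-pos ε)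
                  (proj₁ (cauchy x (½ ℚ.* ε) {{½-pos ε}}) , large))) k
    where
    large : ∀ m → proj₁ (cauchy x (½ ℚ.* ε) {{½-pos ε}}) ≤ m → ½ ℚ.* ε ℚ.≤ ∣ seq x m ∣
    large m N≤m = ℚ.≮⇒≥ λ lt → <⇒≱ℚ (ℚ.≰⇒> p) (begin
      ∣ seq x n ℚ.- 0ℚ ∣
        ≤⟨ distance-trans (seq x n) (seq x m) 0ℚ ⟩
      ∣ seq x n ℚ.- seq x m ∣ ℚ.+ ∣ seq x m ℚ.- 0ℚ ∣
        ≤⟨ ℚ.+-mono-≤ (proj₂ (cauchy x (½ ℚ.* ε) {{½-pos ε}}) n m N≤n N≤m)
             (ℚ.≤-trans (ℚ.≤-reflexive (≡.cong ∣_∣ (ℚ.+-identityʳ (seq x m)))) (ℚ.<⇒≤ lt)) ⟩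
      ½ ℚ.* ε ℚ.+ ½ ℚ.* ε
        ≡⟨ ½+½ ε ⟩
      ε ∎)

1≉0 : 1ℝ ≉ 0ℝ
1≉0 (mk≈ p) = case proj₂ (p ½) (proj₁ (p ½)) ℕ.≤-refl of λ where
  (ℚ.*≤* (ℤ.+≤+ (ℕ.s≤s ())))

-- Transfer to the reals and conclusion

ℝ-field : Field
ℝ-field = record
  { commutativeRing    = ℝ-commutativeRing
  ; homomorphism       = fromℚ-homomorphism
  ; zero-or-invertible = _≈?0
  ; 1≉0                = 1≉0
  }

module Overℝ = OverField ℝ-field

-- Over the reals the two notions of basis have definitionally equal fields.
HasMultiplicity⇒HasDimension : ∀ {n} (A : Matrix n) κ r → HasMultiplicity A κ r →
                               Overℝ.HasDimension (Overℝ.Eigenspace A κ) r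
HasMultiplicity⇒HasDimension {n} A κ r (b , basis) = b , record
  { members     = IsEigenbasis.members {n} {r} {A} {κ} {b} basis
  ; independent = IsEigenbasis.independent {n} {r} {A} {κ} {b} basis
  ; spanning    = IsEigenbasis.spanning {n} {r} {A} {κ} {b} basis
  }

HasDimension⇒HasMultiplicity : ∀ {n} (A : Matrix n) κ r →
  Overℝ.HasDimension (Overℝ.Eigenspace A κ) r → HasMultiplicity A κ r
HasDimension⇒HasMultiplicity {n} A κ r (b , basis) = b , record
  { members     = Overℝ.IsBasis.members {n} {r} {Overℝ.Eigenspace A κ} {b} basis
  ; independent = Overℝ.IsBasis.independent {n} {r} {Overℝ.Eigenspace A κ} {b} basis
  ; spanning    = Overℝ.IsBasis.spanning {n} {r} {Overℝ.Eigenspace A κ} {b} basis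
  }

∈𝒮⇒Fits : ∀ {n} (T : Tree n) (A : Matrix n) → A ∈𝒮 T → ¬ ¬ Overℝ.Fits T A
∈𝒮⇒Fits {n} T A (symmetric , support) = Overℝ.Fits-intro {n} {T} {A} symmetric support

Fits⇒∈𝒮 : ∀ {n} (T : Tree n) (A : Matrix n) → Overℝ.Fits T A → A ∈𝒮 T
Fits⇒∈𝒮 {n} T A fits =
  Overℝ.Fits.symmetric {n} {T} {A} fits , Overℝ.Fits⇒support {n} {T} {A} fits

theorem2p7 : ∀ (k : ℕ) → 4 ≤ k → ∀ {n : ℕ} (T : Tree n) → ¬ (k -NIM T)
theorem2p7 k 4≤k {n} T nim = from-attained (IsMaxMultiplicity.attained isMax)
  where
  open _-NIM_ nim
  r = M ℕ.∸ (k ℕ.∸ 1)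
  3+r≤M : 3 ℕ.+ r ≤ M
  -- From k ≥ 4 follows r ≤ M ∸ 3, and k ≤ M gives 3 ≤ M, so this truncated subtraction is exact.
  3+r≤M = ℕ.≤-trans (ℕ.+-monoʳ-≤ 3 (ℕ.∸-monoʳ-≤ M (ℕ.∸-monoˡ-≤ 1 4≤k)))
    (ℕ.≤-reflexive (ℕ.m+[n∸m]≡n (ℕ.≤-trans (ℕ.≤-trans (ℕ.n≤1+n 3) 4≤k) k≤M)))

  from-attained : ¬ (∃[ A ] ∃[ κ ] A ∈𝒮 T × HasMultiplicity A κ M)
  from-attained (A , κ , A∈T , multiplicity) = ∈𝒮⇒Fits T A A∈T λ fits →
    Overℝ.not-all-simple {n} T {A} {κ} {M} {r} fits
      (HasMultiplicity⇒HasDimension A κ M multiplicity) 3+r≤M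
      λ A′ μ fits′ dim μ-eigenvalue μ≉κ → HasMultiplicity⇒HasDimension A′ μ 1
        (simple A′ κ (Fits⇒∈𝒮 T A′ fits′) (HasDimension⇒HasMultiplicity A′ κ r dim)
          μ μ-eigenvalue μ≉κ)
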